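{- Let $\mathcal{L}$ be a Gorenstein* lattice (over the fixed field $\Bbbk$) and let $\overline{\mathcal{L}}$ be its proper part. Then $\overline{\mathcal{L}}$ is edgewise strongly Cohen--Macaulay, i.e. $\overline{\mathcal{L}}$ is Cohen--Macaulay and, for every closed interval $\mathcal{I}=[a,b]$ of $\overline{\mathcal{L}}$, the poset $\overline{\mathcal{L}}\ominus\mathcal{I}$ is Cohen--Macaulay of the same rank as $\overline{\mathcal{L}}$.
   Context: All posets are finite. Fix a field $\Bbbk$; homology is reduced simplicial homology $\widetilde H_*(\cdot,\Bbbk)$. A simplicial complex $\Delta$ is Cohen--Macaulay if $\widetilde H_i(\mathrm{lk}_\Delta(F),\Bbbk)=0$ for every face $F\in\Delta$ (including the empty face) and every $i<\dim \mathrm{lk}_\Delta(F)$, where $\mathrm{lk}_\Delta(F)=\{G\setminus F: F\subseteq G\in\Delta\}$; it is Gorenstein* if moreover $\widetilde H_i(\mathrm{lk}_\Delta(F),\Bbbk)\cong\Bbbk$ for every face $F$ and $i=\dim\mathrm{lk}_\Delta(F)$. The order complex $\Delta(\mathcal{P})$ of a poset $\mathcal{P}$ is the simplicial complex of its chains; $\mathcal{P}$ is called Cohen--Macaulay (resp. Gorenstein*) if $\Delta(\mathcal{P})$ is. A poset is graded if all maximal chains have the same length (number of elements minus one), called its rank. A cover relation of $\mathcal{P}$ is a pair $(x,y)$ with $x<y$ and no $z$ with $x<z<y$; the Hasse diagram is the graph of cover relations. For a closed interval $\mathcal{I}=[a,b]=\{x: a\le x\le b\}$ of $\mathcal{P}$,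 $\mathcal{P}\ominus\mathcal{I}$ denotes the unique poset on the same ground set whose set of cover relations is the set of cover relations of $\mathcal{P}$ minus those cover relations $(x,y)$ with $x,y\in\mathcal{I}$ (i.e. the Hasse diagram with all edges inside $\mathcal{I}$ removed). A Cohen--Macaulay poset $\mathcal{P}$ is edgewise strongly Cohen--Macaulay if $\mathcal{P}\ominus\mathcal{I}$ is Cohen--Macaulay of the same rank as $\mathcal{P}$ for every closed interval $\mathcal{I}\subseteq\mathcal{P}$. The proper part $\overline{\mathcal{L}}$ of a finite lattice $\mathcal{L}$ is $\mathcal{L}$ with its minimum $\hat0$ and maximum $\hat1$ removed; $\mathcal{L}$ is called a Gorenstein* lattice if $\overline{\mathcal{L}}$ is a Gorenstein* poset. -}

module Defs where

open import Level using (Level; _⊔_)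
open import Data.Bool using (Bool; true; false; _∧_; _∨_; not; if_then_else_)
open import Data.Nat as ℕ using (ℕ; zero; suc; _<_; _≤_; _≡ᵇ_; _<ᵇ_)
open import Data.Fin using (Fin; toℕ)
open import Data.Fin.Subset using (Subset; ∣_∣; _∪_; _∩_; ⁅_⁆)
open import Data.Vec using (lookup; tabulate)
open import Data.Product using (Σ; ∃; _×_; _,_)
open import Relation.Binary.PropositionalEquality using (_≡_)
open import Relation.Nullary using (¬_)
open import Algebra.Bundles using (CommutativeRing)

record Field (c ℓ : Level) : Set (Level.suc (c ⊔ ℓ)) where
  field
    commutativeRing : CommutativeRing c ℓ
  open CommutativeRing commutativeRing public
  field
    0≉1     : ¬ (0# ≈ 1#)
    inverse : ∀ x → ¬ (x ≈ 0#) → Σ Carrier (λ y → (x * y) ≈ 1#)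

allFin : ∀ {m} → (Fin m → Bool) → Bool
allFin {zero}  f = true
allFin {suc m} f = f Fin.zero ∧ allFin (λ i → f (Fin.suc i))

anyFin : ∀ {m} → (Fin m → Bool) → Bool
anyFin {zero}  f = false
anyFin {suc m} f = f Fin.zero ∨ anyFin (λ i → f (Fin.suc i))

_==_ : ∀ {m} → Fin m → Fin m → Bool
x == y = toℕ x ≡ᵇ toℕ y

even : ℕ → Bool
even zero    = true
even (suc n) = not (even n)

-- Finite simplicial complexes on vertex set Fin m, given by the
-- (decidable) predicate "σ is a face".

Complex : ℕ → Set
Complex m = Subset m → Bool

link : ∀ {m} → Complex m → Subset m → Complex m
link Δ F H = (∣ H ∩ F ∣ ≡ᵇ 0) ∧ Δ (H ∪ F)

-- d = (maximal number of vertices of a face) = dim Δ + 1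
MaxFaceSize : ∀ {m} → Complex m → ℕ → Set
MaxFaceSize Δ d =
  (∃ λ σ → Δ σ ≡ true × ∣ σ ∣ ≡ d) × (∀ σ → Δ σ ≡ true → ∣ σ ∣ ≤ d)

-- Reduced simplicial homology with coefficients in a field K.
-- Chains of "size" s (i.e. in homological degree i = s - 1, s ≥ 0, so
-- the empty face gives degree -1: reduced homology) are functions on
-- subsets vanishing off the faces with s vertices.

module Homology {c ℓ} (K : Field c ℓ) where
  open Field K

  sumFin : ∀ {m} → (Fin m → Carrier) → Carrier
  sumFin {zero}  f = 0#
  sumFin {suc m} f = f Fin.zero + sumFin (λ i → f (Fin.suc i))

  record Chain {m} (Δ : Complex m) (s : ℕ) : Set (c ⊔ ℓ) where
    field
      coeff   : Subset m → Carrier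
      support : ∀ σ → (Δ σ ∧ (∣ σ ∣ ≡ᵇ s)) ≡ false → coeff σ ≈ 0#
  open Chain public

  below : ∀ {m} → Fin m → Subset m → ℕ
  below v τ = ∣ τ ∩ tabulate (λ u → toℕ u <ᵇ toℕ v) ∣

  sign : ℕ → Carrier
  sign k = if even k then 1# else - 1#

  ∂ : ∀ {m} → (Subset m → Carrier) → Subset m → Carrier
  ∂ f τ = sumFin (λ v → if lookup τ v then 0#
                        else sign (below v τ) * f (τ ∪ ⁅ v ⁆))

  IsCycle : ∀ {m} {Δ : Complex m} {s} → Chain Δ s → Set ℓ
  IsCycle z = ∀ τ → ∂ (coeff z) τ ≈ 0#

  IsBoundary : ∀ {m} (Δ : Complex m) (s : ℕ) → (Subset m → Carrier) → Set (c ⊔ ℓ)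
  IsBoundary Δ s f = Σ (Chain Δ (suc s)) λ b → ∀ σ → ∂ (coeff b) σ ≈ f σ

  -- H̃_{s-1}(Δ; K) = 0
  HomologyVanishes : ∀ {m} → Complex m → ℕ → Set (c ⊔ ℓ)
  HomologyVanishes Δ s = (z : Chain Δ s) → IsCycle z → IsBoundary Δ s (coeff z)

  -- H̃_{s-1}(Δ; K) ≅ K  (one-dimensional)
  HomologyIsField : ∀ {m} → Complex m → ℕ → Set (c ⊔ ℓ)
  HomologyIsField Δ s =
    Σ (Chain Δ s) λ z → IsCycle z × ¬ IsBoundary Δ s (coeff z) ×
      ((w : Chain Δ s) → IsCycle w →
        Σ Carrier λ a → IsBoundary Δ s (λ σ → coeff w σ - a * coeff z σ))

  -- Cohen–Macaulay: H̃_i(lk F) = 0 for all faces F and i < dim lk F,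
  -- i.e. s = i+1 < d where d = dim lk F + 1.
  CohenMacaulay : ∀ {m} → Complex m → Set (c ⊔ ℓ)
  CohenMacaulay Δ = ∀ F → Δ F ≡ true → ∀ d → MaxFaceSize (link Δ F) d →
    ∀ s → s < d → HomologyVanishes (link Δ F) s

  Gorenstein* : ∀ {m} → Complex m → Set (c ⊔ ℓ)
  Gorenstein* Δ = CohenMacaulay Δ ×
    (∀ F → Δ F ≡ true → ∀ d → MaxFaceSize (link Δ F) d →
      HomologyIsField (link Δ F) d)

-- Finite posets: ground set S ⊆ Fin n with a (decidable) order relation
-- `le` (only its restriction to S matters).

record FinPoset : Set where
  field
    size   : ℕ
    ground : Subset size
    le     : Fin size → Fin size → Bool

module _ (P : FinPoset) where
  open FinPoset P

  orderComplex : Complex size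
  orderComplex σ =
    allFin (λ u → not (lookup σ u) ∨ lookup ground u) ∧
    allFin (λ u → allFin (λ v →
      not (lookup σ u ∧ lookup σ v) ∨ (le u v ∨ le v u)))

  -- every maximal chain has exactly k elements (graded of rank k - 1)
  GradedChainSize : ℕ → Set
  GradedChainSize k = ∀ σ → orderComplex σ ≡ true →
    (∀ v → lookup ground v ≡ true → lookup σ v ≡ false →
       orderComplex (σ ∪ ⁅ v ⁆) ≡ false) →
    ∣ σ ∣ ≡ k

  covers : Fin size → Fin size → Bool
  covers x y = lookup ground x ∧ lookup ground y ∧ not (x == y) ∧ le x y ∧
    not (anyFin (λ z → lookup ground z ∧ not (z == x) ∧ not (z == y) ∧
                       le x z ∧ le z y))

  -- P ⊖ [a,b]: same ground set, order = reflexive–transitive closure of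
  -- the cover relations of P not lying inside [a,b]
  ⊖ : Fin size → Fin size → FinPoset
  ⊖ a b = record { size = size ; ground = ground ; le = reach size }
    where
      inI : Fin size → Bool
      inI x = lookup ground x ∧ le a x ∧ le x b
      cov' : Fin size → Fin size → Bool
      cov' x y = covers x y ∧ not (inI x ∧ inI y)
      reach : ℕ → Fin size → Fin size → Bool
      reach zero    x y = x == y
      reach (suc k) x y = reach k x y ∨ anyFin (λ z → reach k x z ∧ cov' z y)

record FinLattice : Set where
  field
    size   : ℕ
    le     : Fin size → Fin size → Bool
    refl   : ∀ x → le x x ≡ true
    antisym : ∀ x y → le x y ≡ true → le y x ≡ true → x ≡ y
    trans  : ∀ x y z → le x y ≡ true → le y z ≡ true → le x z ≡ true
    join   : ∀ x y → ∃ λ j → le x j ≡ true × le y j ≡ true ×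
               (∀ w → le x w ≡ true → le y w ≡ true → le j w ≡ true)
    meet   : ∀ x y → ∃ λ j → le j x ≡ true × le j y ≡ true ×
               (∀ w → le w x ≡ true → le w y ≡ true → le w j ≡ true)
    bot top : Fin size
    bot-min : ∀ x → le bot x ≡ true
    top-max : ∀ x → le x top ≡ true

  properPart : FinPoset
  properPart = record
    { size = size
    ; ground = tabulate (λ x → not (x == bot) ∧ not (x == top))
    ; le = le }

module Main {c ℓ} (K : Field c ℓ) where
  open Homology K public

  CMPoset : FinPoset → Set (c ⊔ ℓ)
  CMPoset P = CohenMacaulay (orderComplex P)

  GorensteinLattice : FinLattice → Set (c ⊔ ℓ)
  GorensteinLattice L = Gorenstein* (orderComplex (FinLattice.properPart L))

  EdgewiseStronglyCM : FinPoset → Set (c ⊔ ℓ)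
  EdgewiseStronglyCM P = CMPoset P ×
    (∀ a b → lookup (FinPoset.ground P) a ≡ true →
             lookup (FinPoset.ground P) b ≡ true →
             FinPoset.le P a b ≡ true →
       CMPoset (⊖ P a b) ×
       ∃ λ k → GradedChainSize P k × GradedChainSize (⊖ P a b) k)

{-# OPTIONS --safe #-}

-- Let Δ be the order complex of the proper part and I = [a,b]. In a Gorenstein*
-- lattice the order of the proper part ⊖ I is: x < y unless x, y both lie in I.
-- Indeed, if x ∉ I and y ∈ I (say) were joined only through I, then x ∨ a would
-- be comparable with everything in the link of {x,y}, but a homology sphere is
-- not a cone. Hence the order complex Γ of the proper part ⊖ I consists of the
-- chains with at most one element in I.
--
-- The link of a face F in Γ is either its link in Δ or acyclic. Deleting a vertex
-- from a homology sphere leaves an acyclic complex, and so, by induction with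
-- Mayer-Vietoris, does deleting a set of vertices that has a member adjacent to
-- all the others. The vertices of I in the link of F in Δ form such a set, with
-- a join or a meet as its apex. If F meets I, all of them are missing from the
-- link in Γ; otherwise they are put back one at a time, each along an acyclic
-- link.
--
-- Equality in the field is not decidable, so chains are never compared with 0;
-- what is used instead is that the coefficient of the fundamental class along a
-- vertex is nonzero, hence invertible.
module Submission where

open import Level using (Level; _⊔_)
open import Defs
open import Data.Bool using (Bool; true; false; _∧_; _∨_; not; if_then_else_; T)
open import Data.Bool.Properties using () renaming (_≟_ to _≟ᵇ_)
open import Data.Empty using (⊥; ⊥-elim)
open import Data.Fin using (Fin; zero; suc; toℕ; _≟_)
open import Data.Fin.Properties using (toℕ-injective; any?)
open import Data.Fin.Subset renaming (⊥ to ∅)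
open import Data.Fin.Subset.Properties
open import Data.List as List using (List; []; _∷_; filter)
open import Data.List.Membership.Propositional using () renaming (_∈_ to _∈ₗ_)
open import Data.List.Membership.Propositional.Properties
  using (∈-filter⁺; ∈-filter⁻; ∈-allFin)
open import Data.List.Relation.Unary.All as All using (All; []; _∷_)
open import Data.List.Relation.Unary.Any using (here; there)
open import Data.Nat as ℕ using (ℕ; zero; suc; _≤_; _<_; z≤n; s≤s; _<ᵇ_; _≡ᵇ_)
open import Data.Nat.Induction using (<-rec)
import Data.Nat.Properties as ℕₚ
open import Data.Product using (Σ; ∃; _×_; _,_; proj₁; proj₂)
open import Data.Sum as Sum using (_⊎_; inj₁; inj₂; [_,_]′)
open import Data.Vec using ([]; _∷_; lookup; tabulate; here; there)
open import Data.Vec.Properties using ([]=⇒lookup; lookup⇒[]=; lookup∘tabulate; ≡-dec)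
open import Function using (_∘_; id; case_of_; flip)
open import Relation.Binary.Definitions using (tri<; tri≈; tri>)
open import Relation.Binary.PropositionalEquality as ≡ using (_≡_; _≢_; refl)
open import Relation.Nullary using (¬_; Dec; yes; no; does; contradiction)
open import Relation.Nullary.Decidable
  using (_×-dec_; ¬?; decidable-stable; ¬¬-excluded-middle)
open import Relation.Unary using (Decidable)
import Algebra.Properties.Ring as RingProperties
import Relation.Binary.Reasoning.Setoid as SetoidReasoning

T⇒≡true : ∀ {b} → T b → b ≡ true
T⇒≡true {true} _ = refl

≡true⇒T : ∀ {b} → b ≡ true → T b
≡true⇒T refl = _

-- Finite subsets

∉-delete : ∀ {n} (σ : Subset n) v → v ∉ σ - v
∉-delete (_ ∷ σ) (suc v) (there v∈) = ∉-delete σ v v∈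

module _ {n : ℕ} where

  ∉⇒lookup : ∀ {v} {σ : Subset n} → v ∉ σ → lookup σ v ≡ false
  ∉⇒lookup {v} {σ} v∉σ with lookup σ v in eq
  ... | false = refl
  ... | true  = contradiction (lookup⇒[]= v σ eq) v∉σ

  lookup⇒∉ : ∀ {v} {σ : Subset n} → lookup σ v ≡ false → v ∉ σ
  lookup⇒∉ eq v∈σ with ≡.trans (≡.sym eq) ([]=⇒lookup v∈σ)
  ... | ()

  ∈-tabulate⁺ : ∀ {f : Fin n → Bool} {v} → f v ≡ true → v ∈ tabulate f
  ∈-tabulate⁺ {f} {v} eq = lookup⇒[]= v _ (≡.trans (lookup∘tabulate f v) eq)

  ∈-tabulate⁻ : ∀ {f : Fin n → Bool} {v} → v ∈ tabulate f → f v ≡ true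
  ∈-tabulate⁻ {f} {v} v∈ = ≡.trans (≡.sym (lookup∘tabulate f v)) ([]=⇒lookup v∈)

  ∈-insert : ∀ {v} {σ : Subset n} → v ∈ σ ∪ ⁅ v ⁆
  ∈-insert {v} {σ} = q⊆p∪q σ ⁅ v ⁆ (x∈⁅x⁆ v)

  ∉-insert : ∀ {u v} {σ : Subset n} → u ∉ σ → u ≢ v → u ∉ σ ∪ ⁅ v ⁆
  ∉-insert {v = v} {σ} u∉σ u≢v =
    [ u∉σ , u≢v ∘ x∈⁅y⁆⇒x≡y v ]′ ∘ x∈p∪q⁻ σ ⁅ v ⁆

  ∪-⊆ : ∀ {σ τ ρ : Subset n} → σ ⊆ ρ → τ ⊆ ρ → σ ∪ τ ⊆ ρ
  ∪-⊆ {σ} {τ} f g = [ f , g ]′ ∘ x∈p∪q⁻ σ τ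

  ∪-monoˡ-⊆ : ∀ {σ τ ρ : Subset n} → σ ⊆ τ → σ ∪ ρ ⊆ τ ∪ ρ
  ∪-monoˡ-⊆ {σ} {τ} {ρ} f = ∪-⊆ (p⊆p∪q ρ ∘ f) (q⊆p∪q τ ρ)

  ⁅⁆-⊆ : ∀ {v} {σ : Subset n} → v ∈ σ → ⁅ v ⁆ ⊆ σ
  ⁅⁆-⊆ {v} v∈σ x∈ with refl ← x∈⁅y⁆⇒x≡y v x∈ = v∈σ

  ∪-swap : ∀ (σ τ ρ : Subset n) → (σ ∪ τ) ∪ ρ ≡ (σ ∪ ρ) ∪ τ
  ∪-swap σ τ ρ = ≡.trans (∪-assoc σ τ ρ)
    (≡.trans (≡.cong (σ ∪_) (∪-comm τ ρ)) (≡.sym (∪-assoc σ ρ τ)))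

  delete-insert : ∀ {v} {σ : Subset n} → v ∉ σ → (σ ∪ ⁅ v ⁆) - v ≡ σ
  delete-insert {v} {σ} v∉σ = ⊆-antisym to from
    where
    to : (σ ∪ ⁅ v ⁆) - v ⊆ σ
    to {x} x∈ with x∈p∪q⁻ σ ⁅ v ⁆ (p─q⊆p (σ ∪ ⁅ v ⁆) ⁅ v ⁆ x∈)
    ... | inj₁ x∈σ = x∈σ
    ... | inj₂ x∈v with refl ← x∈⁅y⁆⇒x≡y v x∈v = contradiction x∈ (∉-delete _ v)
    from : σ ⊆ (σ ∪ ⁅ v ⁆) - v
    from {x} x∈ = x∈p∧x≢y⇒x∈p-y (p⊆p∪q ⁅ v ⁆ x∈) λ { refl → v∉σ x∈ }

  insert-delete : ∀ {v} {σ : Subset n} → v ∈ σ → (σ - v) ∪ ⁅ v ⁆ ≡ σ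
  insert-delete {v} {σ} v∈σ =
    ⊆-antisym (∪-⊆ (p─q⊆p σ ⁅ v ⁆) (⁅⁆-⊆ v∈σ)) from
    where
    from : σ ⊆ (σ - v) ∪ ⁅ v ⁆
    from {x} x∈ with x ≟ v
    ... | yes refl = ∈-insert
    ... | no x≢v   = p⊆p∪q ⁅ v ⁆ (x∈p∧x≢y⇒x∈p-y x∈ x≢v)

∣insert∩∣ : ∀ {n} {w} {τ B : Subset n} → w ∉ τ → w ∈ B →
            ∣ (τ ∪ ⁅ w ⁆) ∩ B ∣ ≡ suc ∣ τ ∩ B ∣
∣insert∩∣ {w = zero}  {true ∷ τ}  w∉τ here = contradiction here w∉τ
∣insert∩∣ {w = zero}  {false ∷ τ} {true ∷ B} w∉τ here =
  ≡.cong (λ ρ → suc ∣ ρ ∩ B ∣) (∪-identityʳ τ)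
∣insert∩∣ {w = suc w} {x ∷ τ} {y ∷ B} w∉τ (there w∈B)
  with ih ← ∣insert∩∣ {w = w} {τ} {B} (w∉τ ∘ there) w∈B
  with x | y
... | false | _     = ih
... | true  | false = ih
... | true  | true  = ≡.cong suc ih

insert∩ : ∀ {n} {w} {τ B : Subset n} → w ∉ B → (τ ∪ ⁅ w ⁆) ∩ B ≡ τ ∩ B
insert∩ {w = w} {τ} {B} w∉B = ⊆-antisym to
  λ x∈ → let x∈τ , x∈B = x∈p∩q⁻ τ B x∈ in x∈p∩q⁺ (p⊆p∪q ⁅ w ⁆ x∈τ , x∈B)
  where
  to : (τ ∪ ⁅ w ⁆) ∩ B ⊆ τ ∩ B
  to x∈ with x∈p∩q⁻ (τ ∪ ⁅ w ⁆) B x∈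
  ... | x∈τw , x∈B with x∈p∪q⁻ τ ⁅ w ⁆ x∈τw
  ...   | inj₁ x∈τ = x∈p∩q⁺ (x∈τ , x∈B)
  ...   | inj₂ x∈w with refl ← x∈⁅y⁆⇒x≡y w x∈w = contradiction x∈B w∉B

∣insert∣ : ∀ {n} {w} {τ : Subset n} → w ∉ τ → ∣ τ ∪ ⁅ w ⁆ ∣ ≡ suc ∣ τ ∣
∣insert∣ {w = w} {τ} w∉τ = begin
  ∣ τ ∪ ⁅ w ⁆ ∣        ≡⟨ ≡.cong ∣_∣ (∩-identityʳ (τ ∪ ⁅ w ⁆)) ⟨
  ∣ (τ ∪ ⁅ w ⁆) ∩ ⊤ ∣  ≡⟨ ∣insert∩∣ w∉τ (⊆⊤ {p = ⁅ w ⁆} (x∈⁅x⁆ w)) ⟩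
  suc ∣ τ ∩ ⊤ ∣        ≡⟨ ≡.cong (suc ∘ ∣_∣) (∩-identityʳ τ) ⟩
  suc ∣ τ ∣            ∎
  where open ≡.≡-Reasoning

∣delete∣ : ∀ {n} {w} {τ : Subset n} → w ∈ τ → suc ∣ τ - w ∣ ≡ ∣ τ ∣
∣delete∣ {w = w} {τ} w∈τ =
  ≡.trans (≡.sym (∣insert∣ (∉-delete τ w))) (≡.cong ∣_∣ (insert-delete w∈τ))

∣σ∣≡0⇒∉ : ∀ {n} {v} {σ : Subset n} → ∣ σ ∣ ≡ 0 → v ∉ σ
∣σ∣≡0⇒∉ eq v∈σ with ≡.trans (∣delete∣ v∈σ) eq
... | ()

-- Contractions and exterior multiplications

module Operators {c ℓ} (K : Field c ℓ) where
  open Field K hiding (zero; _-_) renaming (refl to ≈-refl; sym to ≈-sym; trans to ≈-trans)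
  open Homology K
  open RingProperties ring
  open SetoidReasoning setoid

  private variable
    n : ℕ
    σ τ : Subset n
    u v : Fin n

  *-zero : ∀ {x y} → y ≈ 0# → x * y ≈ 0#
  *-zero {x} y≈0 = ≈-trans (*-congˡ y≈0) (zeroʳ x)

  +-zero : ∀ {x y} → x ≈ 0# → y ≈ 0# → x + y ≈ 0#
  +-zero x≈0 y≈0 = ≈-trans (+-cong x≈0 y≈0) (+-identityˡ 0#)

  +-interchange : ∀ w x y z → (w + x) + (y + z) ≈ (w + y) + (x + z)
  +-interchange w x y z = begin
    (w + x) + (y + z)  ≈⟨ +-assoc w x (y + z) ⟩
    w + (x + (y + z))  ≈⟨ +-congˡ (+-assoc x y z) ⟨
    w + ((x + y) + z)  ≈⟨ +-congˡ (+-congʳ (+-comm x y)) ⟩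
    w + ((y + x) + z)  ≈⟨ +-congˡ (+-assoc y x z) ⟩
    w + (y + (x + z))  ≈⟨ +-assoc w y (x + z) ⟨
    (w + y) + (x + z)  ∎

  *-leftSwap : ∀ x y z → x * (y * z) ≈ y * (x * z)
  *-leftSwap x y z = begin
    x * (y * z)  ≈⟨ *-assoc x y z ⟨
    (x * y) * z  ≈⟨ *-congʳ (*-comm x y) ⟩
    (y * x) * z  ≈⟨ *-assoc y x z ⟩
    y * (x * z)  ∎

  Unit : Carrier → Set (c ⊔ ℓ)
  Unit x = Σ Carrier λ y → x * y ≈ 1#

  unit-cancel : ∀ {x y} → Unit x → y * x ≈ 0# → y ≈ 0#
  unit-cancel {x} {y} (x⁻¹ , xx⁻¹≈1) yx≈0 = begin
    y              ≈⟨ *-identityʳ y ⟨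
    y * 1#         ≈⟨ *-congˡ xx⁻¹≈1 ⟨
    y * (x * x⁻¹)  ≈⟨ *-assoc y x x⁻¹ ⟨
    (y * x) * x⁻¹  ≈⟨ *-congʳ yx≈0 ⟩
    0# * x⁻¹       ≈⟨ zeroˡ x⁻¹ ⟩
    0#             ∎

  sum-cong : {f g : Fin n → Carrier} → (∀ i → f i ≈ g i) → sumFin f ≈ sumFin g
  sum-cong {zero}  f≈g = ≈-refl
  sum-cong {suc n} f≈g = +-cong (f≈g zero) (sum-cong (f≈g ∘ suc))

  sum-zero : {f : Fin n → Carrier} → (∀ i → f i ≈ 0#) → sumFin f ≈ 0#
  sum-zero {zero}  f≈0 = ≈-refl
  sum-zero {suc n} f≈0 = +-zero (f≈0 zero) (sum-zero (f≈0 ∘ suc))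

  sum-+ : (f g : Fin n → Carrier) →
          sumFin (λ i → f i + g i) ≈ sumFin f + sumFin g
  sum-+ {zero}  f g = ≈-sym (+-identityˡ 0#)
  sum-+ {suc n} f g = ≈-trans (+-congˡ (sum-+ (f ∘ suc) (g ∘ suc)))
    (+-interchange _ _ _ _)

  sum-* : (a : Carrier) (f : Fin n → Carrier) →
          sumFin (λ i → a * f i) ≈ a * sumFin f
  sum-* {zero}  a f = ≈-sym (zeroʳ a)
  sum-* {suc n} a f = ≈-trans (+-congˡ (sum-* a (f ∘ suc)))
    (≈-sym (distribˡ a _ _))

  sum-single : (f : Fin n → Carrier) (u : Fin n) →
               (∀ i → i ≢ u → f i ≈ 0#) → sumFin f ≈ f u
  sum-single f zero    f≈0 = ≈-trans
    (+-congˡ (sum-zero λ i → f≈0 (suc i) λ ())) (+-identityʳ _)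
  sum-single f (suc u) f≈0 = ≈-trans
    (+-cong (f≈0 zero λ ())
      (sum-single (f ∘ suc) u λ i i≢u → f≈0 (suc i) λ { refl → i≢u refl }))
    (+-identityˡ _)

  -- Induction on `n`: the first row cancels the first column entry by entry. The diagonal has its
  -- own hypothesis because in characteristic 2 antisymmetry does not make it vanish.
  sum-alternating : (a : Fin n → Fin n → Carrier) → (∀ i → a i i ≈ 0#) →
    (∀ i j → a i j + a j i ≈ 0#) → sumFin (λ i → sumFin (a i)) ≈ 0#
  sum-alternating {zero}  a diag anti = ≈-refl
  sum-alternating {suc n} a diag anti = begin
    (a zero zero + row) + sumFin (λ i → a (suc i) zero + sumFin (a (suc i) ∘ suc))
      ≈⟨ +-cong (≈-trans (+-congʳ (diag zero)) (+-identityˡ row))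
           (sum-+ (λ i → a (suc i) zero) (λ i → sumFin (a (suc i) ∘ suc))) ⟩
    row + (col + rest)  ≈⟨ +-assoc row col rest ⟨
    (row + col) + rest
      ≈⟨ +-zero
           (≈-trans (≈-sym (sum-+ (a zero ∘ suc) (λ i → a (suc i) zero)))
                    (sum-zero λ i → anti zero (suc i)))
           (sum-alternating (λ i j → a (suc i) (suc j)) (diag ∘ suc)
             (λ i j → anti (suc i) (suc j))) ⟩
    0# ∎
    where
    row  = sumFin (a zero ∘ suc)
    col  = sumFin (λ i → a (suc i) zero)
    rest = sumFin (λ i → sumFin (a (suc i) ∘ suc))

  sign-suc : ∀ k → sign (suc k) ≈ - sign k
  sign-suc k with even k
  ... | true  = ≈-refl
  ... | false = ≈-sym (-‿involutive 1#)

  sign² : ∀ k → sign k * sign k ≈ 1#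
  sign² k with even k
  ... | true  = *-identityˡ 1#
  ... | false = ≈-trans (-1*x≈-x (- 1#)) (-‿involutive 1#)

  Coeffs : ℕ → Set c
  Coeffs n = Subset n → Carrier

  infix 4 _≋_
  _≋_ : Coeffs n → Coeffs n → Set ℓ
  f ≋ g = ∀ σ → f σ ≈ g σ

  infix 4 _≋0
  _≋0 : Coeffs n → Set ℓ
  f ≋0 = ∀ σ → f σ ≈ 0#

  infixl 6 _⊕_·_
  _⊕_·_ : Coeffs n → Carrier → Coeffs n → Coeffs n
  (f ⊕ a · g) σ = f σ + a * g σ

  -- Contraction with v and exterior multiplication by v. As ι v is the v-th
  -- summand of ∂, the value ∂ f τ unfolds to Σᵥ ι v f τ.
  ι : Fin n → Coeffs n → Coeffs n
  ι v f τ = if lookup τ v then 0# else sign (below v τ) * f (τ ∪ ⁅ v ⁆)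

  ε : Fin n → Coeffs n → Coeffs n
  ε v f σ = if lookup σ v then sign (below v (σ - v)) * f (σ - v) else 0#

  ι-∈ : ∀ {f : Coeffs n} → v ∈ τ → ι v f τ ≈ 0#
  ι-∈ v∈τ rewrite []=⇒lookup v∈τ = ≈-refl

  ι-∉ : ∀ {f : Coeffs n} → v ∉ τ →
        ι v f τ ≈ sign (below v τ) * f (τ ∪ ⁅ v ⁆)
  ι-∉ v∉τ rewrite ∉⇒lookup v∉τ = ≈-refl

  ε-∈ : ∀ {f : Coeffs n} → v ∈ σ →
        ε v f σ ≈ sign (below v (σ - v)) * f (σ - v)
  ε-∈ v∈σ rewrite []=⇒lookup v∈σ = ≈-refl

  ε-∉ : ∀ {f : Coeffs n} → v ∉ σ → ε v f σ ≈ 0#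
  ε-∉ v∉σ rewrite ∉⇒lookup v∉σ = ≈-refl

  ι-local : ∀ {f g : Coeffs n} → f (τ ∪ ⁅ v ⁆) ≈ g (τ ∪ ⁅ v ⁆) →
            ι v f τ ≈ ι v g τ
  ι-local {τ = τ} {v} f≈g with lookup τ v
  ... | true  = ≈-refl
  ... | false = *-congˡ f≈g

  ι-cong : ∀ {f g : Coeffs n} → f ≋ g → ι v f ≋ ι v g
  ι-cong {f = f} {g} f≋g τ = ι-local {f = f} {g} (f≋g _)

  ι-zero : ∀ {f : Coeffs n} → (v ∉ τ → f (τ ∪ ⁅ v ⁆) ≈ 0#) → ι v f τ ≈ 0#
  ι-zero {v = v} {τ} f≈0 with lookup τ v in eq
  ... | true  = ≈-refl
  ... | false = *-zero (f≈0 (lookup⇒∉ eq))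

  ι-⊕ : ∀ (v : Fin n) f a g → ι v (f ⊕ a · g) ≋ ι v f ⊕ a · ι v g
  ι-⊕ v f a g τ with lookup τ v
  ... | true  = ≈-sym (≈-trans (+-identityˡ _) (zeroʳ a))
  ... | false = begin
    s * (f τv + a * g τv)        ≈⟨ distribˡ s _ _ ⟩
    s * f τv + s * (a * g τv)    ≈⟨ +-congˡ (*-leftSwap s a (g τv)) ⟩
    s * f τv + a * (s * g τv)    ∎
    where
    s  = sign (below v τ)
    τv = τ ∪ ⁅ v ⁆

  ι-· : ∀ (v : Fin n) a g → ι v (λ σ → a * g σ) ≋ λ τ → a * ι v g τ
  ι-· v a g τ with lookup τ v
  ... | true  = ≈-sym (zeroʳ a)
  ... | false = *-leftSwap _ a _

  ι-sum : ∀ {m} (v : Fin n) (f : Fin m → Coeffs n) →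
          ι v (λ σ → sumFin (λ i → f i σ)) ≋ λ τ → sumFin (λ i → ι v (f i) τ)
  ι-sum {m = m} v f τ with lookup τ v
  ... | true  = ≈-sym (sum-zero {m} λ _ → ≈-refl)
  ... | false = ≈-sym (sum-* _ (λ i → f i (τ ∪ ⁅ v ⁆)))

  ∂-cong : ∀ {f g : Coeffs n} → f ≋ g → ∂ f ≋ ∂ g
  ∂-cong {f = f} {g} f≋g τ = sum-cong λ v → ι-cong {v = v} {f} {g} f≋g τ

  ∂-zero : ∀ {f : Coeffs n} → (∀ v → v ∉ τ → f (τ ∪ ⁅ v ⁆) ≈ 0#) → ∂ f τ ≈ 0#
  ∂-zero {f = f} f≈0 = sum-zero λ v → ι-zero {f = f} (f≈0 v)

  ∂-⊕ : ∀ (f : Coeffs n) a g → ∂ (f ⊕ a · g) ≋ ∂ f ⊕ a · ∂ g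
  ∂-⊕ f a g τ = begin
    ∂ (f ⊕ a · g) τ  ≈⟨ sum-cong (λ v → ι-⊕ v f a g τ) ⟩
    sumFin (λ v → ι v f τ + a * ι v g τ)
      ≈⟨ sum-+ (λ v → ι v f τ) (λ v → a * ι v g τ) ⟩
    ∂ f τ + sumFin (λ v → a * ι v g τ)  ≈⟨ +-congˡ (sum-* a (λ v → ι v g τ)) ⟩
    ∂ f τ + a * ∂ g τ  ∎

  initial : Fin n → Subset n
  initial v = tabulate (λ u → toℕ u <ᵇ toℕ v)

  below-< : toℕ u < toℕ v → u ∉ τ → below v (τ ∪ ⁅ u ⁆) ≡ suc (below v τ)
  below-< u<v u∉τ = ∣insert∩∣ u∉τ (∈-tabulate⁺ (T⇒≡true (ℕₚ.<⇒<ᵇ u<v)))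

  below-≤ : ∀ (τ : Subset n) → toℕ v ≤ toℕ u → below v (τ ∪ ⁅ u ⁆) ≡ below v τ
  below-≤ {v = v} {u} τ v≤u = ≡.cong ∣_∣ (insert∩ {τ = τ} λ u∈ → ℕₚ.≤⇒≯ v≤u
    (ℕₚ.<ᵇ⇒< (toℕ u) (toℕ v) (≡true⇒T (∈-tabulate⁻ u∈))))

  ι² : ∀ (v : Fin n) f → ι v (ι v f) ≋0
  ι² v f τ = ι-zero {f = ι v f} λ _ → ι-∈ {f = f} ∈-insert

  -- Inserting `u` adds one element below `v`, while inserting `v` adds none below `u`; so the two
  -- orders of contraction differ by exactly one sign.
  ι-anticomm-< : ∀ (f : Coeffs n) → toℕ u < toℕ v → u ∉ τ → v ∉ τ →
                 ι u (ι v f) τ + ι v (ι u f) τ ≈ 0#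
  ι-anticomm-< {u = u} {v} {τ} f u<v u∉τ v∉τ = begin
    ι u (ι v f) τ + ι v (ι u f) τ
      ≈⟨ +-cong (≈-trans (ι-∉ {f = ι v f} u∉τ) (*-congˡ uv))
                (≈-trans (ι-∉ {f = ι u f} v∉τ) (*-congˡ vu)) ⟩
    su * (- sv * x) + sv * (su * x)
      ≈⟨ +-cong (*-leftSwap su (- sv) x) (≈-refl) ⟩
    - sv * (su * x) + sv * (su * x)  ≈⟨ +-congʳ (-‿distribˡ-* sv _) ⟨
    - (sv * (su * x)) + sv * (su * x)  ≈⟨ -‿inverseˡ _ ⟩
    0#  ∎
    where
    u≢v : u ≢ v
    u≢v refl = ℕₚ.<-irrefl refl u<v
    su = sign (below u τ)
    sv = sign (below v τ)
    x  = f ((τ ∪ ⁅ u ⁆) ∪ ⁅ v ⁆)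
    uv : ι v f (τ ∪ ⁅ u ⁆) ≈ - sv * x
    uv = ≈-trans (ι-∉ {f = f} (∉-insert v∉τ (u≢v ∘ ≡.sym)))
      (*-congʳ (≈-trans (reflexive (≡.cong sign (below-< u<v u∉τ)))
                        (sign-suc (below v τ))))
    vu : ι u f (τ ∪ ⁅ v ⁆) ≈ su * x
    vu = ≈-trans (ι-∉ {f = f} (∉-insert u∉τ u≢v))
      (*-cong (reflexive (≡.cong sign (below-≤ τ (ℕₚ.<⇒≤ u<v))))
              (reflexive (≡.cong f (∪-swap τ ⁅ v ⁆ ⁅ u ⁆))))

  ι-anticomm : ∀ (u v : Fin n) f τ → ι u (ι v f) τ + ι v (ι u f) τ ≈ 0#
  ι-anticomm u v f τ with u ∈? τ | v ∈? τ
  ... | yes u∈τ | _ = +-zero (ι-∈ {f = ι v f} u∈τ)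
    (ι-zero {f = ι u f} λ _ → ι-∈ {f = f} (p⊆p∪q ⁅ v ⁆ u∈τ))
  ... | no  _   | yes v∈τ = +-zero
    (ι-zero {f = ι v f} λ _ → ι-∈ {f = f} (p⊆p∪q ⁅ u ⁆ v∈τ)) (ι-∈ {f = ι u f} v∈τ)
  ... | no  u∉τ | no v∉τ with ℕₚ.<-cmp (toℕ u) (toℕ v)
  ...   | tri< u<v _ _ = ι-anticomm-< f u<v u∉τ v∉τ
  ...   | tri≈ _ u≡v _ with refl ← toℕ-injective u≡v =
    +-zero (ι² u f τ) (ι² u f τ)
  ...   | tri> _ _ v<u = ≈-trans (+-comm _ _) (ι-anticomm-< f v<u v∉τ u∉τ)

  ∂² : ∀ (f : Coeffs n) → ∂ (∂ f) ≋0
  ∂² f τ = ≈-trans (sum-cong λ v → ι-sum v (λ u → ι u f) τ)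
    (sum-alternating (λ v u → ι v (ι u f) τ) (λ v → ι² v f τ)
      (λ v u → ι-anticomm v u f τ))

  -- `∂` is the sum of all contractions, each of which anticommutes with `ι v`. Up to sign,
  -- contraction is thus a chain map onto the link of `v`.
  ι-∂ : ∀ (v : Fin n) f → ι v (∂ f) ≋ λ τ → - ∂ (ι v f) τ
  ι-∂ v f τ = +-inverseˡ-unique _ _ (begin
    ι v (∂ f) τ + ∂ (ι v f) τ
      ≈⟨ +-congʳ (ι-sum v (λ u → ι u f) τ) ⟩
    sumFin (λ u → ι v (ι u f) τ) + ∂ (ι v f) τ
      ≈⟨ sum-+ (λ u → ι v (ι u f) τ) (λ u → ι u (ι v f) τ) ⟨
    sumFin (λ u → ι v (ι u f) τ + ι u (ι v f) τ)
      ≈⟨ sum-zero (λ u → ι-anticomm v u f τ) ⟩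
    0#  ∎)

  ι-ε : ∀ {f : Coeffs n} → (∀ {τ} → v ∈ τ → f τ ≈ 0#) → ι v (ε v f) ≋ f
  ι-ε {v = v} {f} f≈0 τ with v ∈? τ
  ... | yes v∈τ = ≈-trans (ι-∈ {f = ε v f} v∈τ) (≈-sym (f≈0 v∈τ))
  ... | no  v∉τ = begin
    ι v (ε v f) τ                    ≈⟨ ι-∉ {f = ε v f} v∉τ ⟩
    s * ε v f (τ ∪ ⁅ v ⁆)            ≈⟨ *-congˡ (ε-∈ {f = f} ∈-insert) ⟩
    s * (sign (below v τ′) * f τ′)   ≈⟨ *-congˡ (reflexive
      (≡.cong (λ ρ → sign (below v ρ) * f ρ) (delete-insert v∉τ))) ⟩
    s * (s * f τ)                    ≈⟨ *-assoc s s (f τ) ⟨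
    (s * s) * f τ                    ≈⟨ *-congʳ (sign² (below v τ)) ⟩
    1# * f τ                         ≈⟨ *-identityˡ (f τ) ⟩
    f τ                              ∎
    where
    s  = sign (below v τ)
    τ′ = (τ ∪ ⁅ v ⁆) - v

  -- On sets containing `v`, contraction only relabels coefficients and multiplies them by signs,
  -- and signs are invertible.
  ι-detects : ∀ {f : Coeffs n} → v ∈ σ → ι v f (σ - v) ≈ 0# → f σ ≈ 0#
  ι-detects {v = v} {σ} {f} v∈σ ιf≈0 = begin
    f σ              ≈⟨ *-identityˡ (f σ) ⟨
    1# * f σ         ≈⟨ *-congʳ (sign² (below v (σ - v))) ⟨
    (s * s) * f σ    ≈⟨ *-assoc s s (f σ) ⟩
    s * (s * f σ)    ≈⟨ *-congˡ (*-congˡ (reflexive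
      (≡.cong f (insert-delete v∈σ)))) ⟨
    s * (s * f ((σ - v) ∪ ⁅ v ⁆))  ≈⟨ *-congˡ (ι-∉ {f = f} (∉-delete σ v)) ⟨
    s * ι v f (σ - v)  ≈⟨ *-zero ιf≈0 ⟩
    0#  ∎
    where s = sign (below v (σ - v))

-- Acyclic complexes

-- Complexes as propositions rather than Booleans: links and deletions are then plain conjunctions,
-- compared up to `≐`.
Faces : ℕ → Set₁
Faces n = Subset n → Set

module _ {n : ℕ} where

  infix 4 _≐_
  _≐_ : Faces n → Faces n → Set
  X ≐ Y = ∀ σ → (X σ → Y σ) × (Y σ → X σ)

  ≐-sym : ∀ {X Y} → X ≐ Y → Y ≐ X
  ≐-sym e σ = proj₂ (e σ) , proj₁ (e σ)

  ≐-trans : ∀ {X Y Z} → X ≐ Y → Y ≐ Z → X ≐ Z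
  ≐-trans e e′ σ = proj₁ (e′ σ) ∘ proj₁ (e σ) , proj₂ (e σ) ∘ proj₂ (e′ σ)

  DownClosed : Faces n → Set
  DownClosed X = ∀ {σ τ} → τ ⊆ σ → X σ → X τ

  lk : Faces n → Fin n → Faces n
  lk X v τ = v ∉ τ × X (τ ∪ ⁅ v ⁆)

  del : Faces n → Fin n → Faces n
  del X v σ = X σ × v ∉ σ

  lk-≐ : ∀ {X Y} v → X ≐ Y → lk X v ≐ lk Y v
  lk-≐ v e τ = (λ (v∉ , x) → v∉ , proj₁ (e _) x)
             , (λ (v∉ , y) → v∉ , proj₂ (e _) y)

  lk-down : ∀ {X v} → DownClosed X → DownClosed (lk X v)
  lk-down down τ⊆σ (v∉σ , x) = v∉σ ∘ τ⊆σ , down (∪-monoˡ-⊆ τ⊆σ) x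

  del-down : ∀ {X v} → DownClosed X → DownClosed (del X v)
  del-down down τ⊆σ (x , v∉σ) = down τ⊆σ x , v∉σ ∘ τ⊆σ

module Acyclicity {c ℓ} (K : Field c ℓ) where
  open Field K hiding (zero; _-_) renaming (refl to ≈-refl; sym to ≈-sym; trans to ≈-trans)
  open Homology K
  open RingProperties ring
  open SetoidReasoning setoid
  open Operators K

  private variable
    n : ℕ
    X Y : Faces n

  Supported : Faces n → ℕ → Coeffs n → Set ℓ
  Supported X s f = ∀ σ → ¬ (X σ × ∣ σ ∣ ≡ s) → f σ ≈ 0#

  Cycle : Coeffs n → Set ℓ
  Cycle f = ∂ f ≋0

  Bounds : Faces n → ℕ → Coeffs n → Set (c ⊔ ℓ)
  Bounds X s f = Σ (Coeffs _) λ b → Supported X (suc s) b × ∂ b ≋ f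

  Vanishes : Faces n → ℕ → Set (c ⊔ ℓ)
  Vanishes X s = ∀ f → Supported X s f → Cycle f → Bounds X s f

  -- Size 0 is included, so the complex whose only face is `∅` is not acyclic, whereas the complex
  -- without any faces is.
  Acyclic : Faces n → Set (c ⊔ ℓ)
  Acyclic X = ∀ s → Vanishes X s

  Supported-mono : ∀ {s f} → (∀ {σ} → X σ → Y σ) →
                   Supported X s f → Supported Y s f
  Supported-mono X⇒Y supp σ ¬y = supp σ λ (x , eq) → ¬y (X⇒Y x , eq)

  Vanishes-≐ : ∀ {s} → X ≐ Y → Vanishes X s → Vanishes Y s
  Vanishes-≐ e van f supp cyc =
    let b , bsupp , ∂b = van f (Supported-mono (proj₂ (e _)) supp) cyc
    in b , Supported-mono (proj₁ (e _)) bsupp , ∂b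

  Acyclic-≐ : X ≐ Y → Acyclic X → Acyclic Y
  Acyclic-≐ e acyc s = Vanishes-≐ e (acyc s)

  0-Cycle : Cycle {n} (λ _ → 0#)
  0-Cycle τ = ∂-zero {τ = τ} {f = λ _ → 0#} λ _ _ → ≈-refl

  ≋0⇒Bounds : ∀ {s f} → f ≋0 → Bounds X s f
  ≋0⇒Bounds f≈0 = (λ _ → 0#) , (λ _ _ → ≈-refl) ,
    λ σ → ≈-trans (0-Cycle σ) (≈-sym (f≈0 σ))

  void-Acyclic : (∀ σ → ¬ X σ) → Acyclic X
  void-Acyclic ¬X s f supp _ = ≋0⇒Bounds λ σ → supp σ (¬X σ ∘ proj₁)

  ⊕-Supported : ∀ {s f g} a → Supported X s f → Supported X s g →
                Supported X s (f ⊕ a · g)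
  ⊕-Supported a f g σ ¬x = +-zero (f σ ¬x) (*-zero (g σ ¬x))

  ⊕-Cycle : ∀ {f g : Coeffs n} a → Cycle f → Cycle g → Cycle (f ⊕ a · g)
  ⊕-Cycle {f = f} {g} a f-cyc g-cyc τ =
    ≈-trans (∂-⊕ f a g τ) (+-zero (f-cyc τ) (*-zero (g-cyc τ)))

  ∂-⊕-Cycle : ∀ {f g : Coeffs n} a → Cycle g → ∂ (f ⊕ a · g) ≋ ∂ f
  ∂-⊕-Cycle {f = f} {g} a g-cyc τ = ≈-trans (∂-⊕ f a g τ)
    (≈-trans (+-congˡ (*-zero (g-cyc τ))) (+-identityʳ _))

  ι-Supported : ∀ {s f} v → Supported X (suc s) f → Supported (lk X v) s (ι v f)
  ι-Supported {f = f} v supp τ ¬x = ι-zero {f = f} λ v∉τ → supp _ λ (x , eq) →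
    ¬x ((v∉τ , x) , ℕₚ.suc-injective (≡.trans (≡.sym (∣insert∣ v∉τ)) eq))

  ι-Cycle : ∀ (v : Fin n) {f g} → ∂ f ≋ g → ι v g ≋0 → Cycle (ι v f)
  ι-Cycle v {f} {g} ∂f≈g ιg≈0 τ = begin
    ∂ (ι v f) τ        ≈⟨ -‿involutive _ ⟨
    - - ∂ (ι v f) τ    ≈⟨ -‿cong (ι-∂ v f τ) ⟨
    - ι v (∂ f) τ      ≈⟨ -‿cong (≈-trans (ι-cong {v = v} ∂f≈g τ) (ιg≈0 τ)) ⟩
    - 0#               ≈⟨ -0#≈0# ⟩
    0#                 ∎

  ε-Supported : ∀ {s e} v → Supported (lk X v) s e → Supported X (suc s) (ε v e)
  ε-Supported {X = X} {s = s} {e} v supp σ ¬x with v ∈? σ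
  ... | no  v∉σ = ε-∉ {f = e} v∉σ
  ... | yes v∈σ = ≈-trans (ε-∈ {f = e} v∈σ) (*-zero (supp (σ - v)
    λ ((_ , x) , eq) → ¬x (≡.subst X (insert-delete v∈σ) x ,
                           ≡.trans (≡.sym (∣delete∣ v∈σ)) (≡.cong suc eq))))

  ι-ε-lk : ∀ {s e} v → Supported (lk X v) s e → ι v (ε v e) ≋ e
  ι-ε-lk v supp = ι-ε λ v∈τ → supp _ λ ((v∉τ , _) , _) → v∉τ v∈τ

  ∂-Supported : ∀ {s f} → DownClosed X → Supported X (suc s) f →
                Supported X s (∂ f)
  ∂-Supported {f = f} down supp τ ¬x = ∂-zero {f = f} λ v v∉τ → supp _ λ (x , eq) →
    ¬x (down (p⊆p∪q ⁅ v ⁆) x ,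
        ℕₚ.suc-injective (≡.trans (≡.sym (∣insert∣ v∉τ)) eq))

  -- Being a chain of the deletion is expressed by `ι v f ≋0`; pushing a chain off `v` therefore
  -- amounts to killing its contraction.
  del-Supported : ∀ {s f} v → Supported X s f → ι v f ≋0 → Supported (del X v) s f
  del-Supported {f = f} v supp ιf≈0 σ ¬x with v ∈? σ
  ... | yes v∈σ = ι-detects {f = f} v∈σ (ιf≈0 (σ - v))
  ... | no  v∉σ = supp σ λ (x , eq) → ¬x ((x , v∉σ) , eq)

  ι-del : ∀ {s f} v → Supported (del X v) s f → ι v f ≋0
  ι-del {f = f} v supp τ = ι-zero {f = f} λ _ → supp _ λ ((_ , v∉) , _) → v∉ ∈-insert

  -- Contracting `∂ (ε v e)` gives `- ∂ e`, because `ι v` anticommutes with `∂` and undoes `ε v` on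
  -- chains of the link.
  ι-correct : ∀ {s} v f {e} → Supported (lk X v) s e → ∂ e ≋ ι v f →
              ι v (f ⊕ 1# · ∂ (ε v e)) ≋0
  ι-correct {X = X} v f {e} e-supp ∂e τ = begin
    ι v (f ⊕ 1# · ∂ (ε v e)) τ            ≈⟨ ι-⊕ v f 1# (∂ (ε v e)) τ ⟩
    ι v f τ + 1# * ι v (∂ (ε v e)) τ      ≈⟨ +-congˡ (*-identityˡ _) ⟩
    ι v f τ + ι v (∂ (ε v e)) τ           ≈⟨ +-congˡ (ι-∂ v (ε v e) τ) ⟩
    ι v f τ + - ∂ (ι v (ε v e)) τ         ≈⟨ +-congˡ (-‿cong
      (∂-cong {f = ι v (ε v e)} (ι-ε-lk {X = X} v e-supp) τ)) ⟩
    ι v f τ + - ∂ e τ                     ≈⟨ +-congˡ (-‿cong (∂e τ)) ⟩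
    ι v f τ + - ι v f τ                   ≈⟨ -‿inverseʳ _ ⟩
    0#                                    ∎

  -- If the contraction of a filling `b` bounds `e` in the link, adding `∂ (ε v e)` moves `b` off
  -- `v` and leaves its boundary unchanged, by `∂²`.
  avoid : ∀ {s f} v → DownClosed X → Supported (del X v) s f →
    (b : Bounds X s f) → Bounds (lk X v) s (ι v (proj₁ b)) → Bounds (del X v) s f
  avoid {X = X} {f = f} v down supp (b , b-supp , ∂b) (e , e-supp , ∂e) =
    b ⊕ 1# · ∂ (ε v e) ,
    del-Supported v
      (⊕-Supported 1# b-supp (∂-Supported down (ε-Supported v e-supp)))
      (ι-correct {X = X} v b e-supp ∂e) ,
    λ τ → ≈-trans (∂-⊕-Cycle {f = b} {∂ (ε v e)} 1# (∂² (ε v e)) τ) (∂b τ)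

  -- This and `add-Acyclic` are the two uses of Mayer-Vietoris for the union of the deletion and the
  -- star of `v`, which meet in the link; both are done by explicit chains.
  del-Acyclic : ∀ v → DownClosed X → Acyclic X → Acyclic (lk X v) → Acyclic (del X v)
  del-Acyclic v down acyc acyc-lk s f supp cyc =
    let b , b-supp , ∂b = acyc s f (Supported-mono proj₁ supp) cyc
    in avoid v down supp (b , b-supp , ∂b)
         (acyc-lk s (ι v b) (ι-Supported v b-supp)
           (ι-Cycle v {b} ∂b (ι-del v supp)))

  add-Acyclic : ∀ v → DownClosed X → Acyclic (del X v) → Acyclic (lk X v) → Acyclic X
  add-Acyclic {X = X} v down acyc acyc-lk zero f supp cyc =
    -- A chain of size 0 lives on `∅` alone and so avoids `v` already.
    let b , b-supp , ∂b = acyc zero f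
          (del-Supported v supp λ τ → ι-zero {v = v} {τ} {f = f} λ v∉τ → supp _
             λ (_ , eq) → ∣σ∣≡0⇒∉ {σ = τ ∪ ⁅ v ⁆} eq ∈-insert)
          cyc
    in b , Supported-mono proj₁ b-supp , ∂b
  add-Acyclic {X = X} v down acyc acyc-lk (suc s) f supp cyc =
    -- Here `b` fills `f + ∂ (ε v e)`, the representative of `f` off `v`; the correction is then
    -- taken back.
    b ⊕ - 1# · ε v e ,
    ⊕-Supported (- 1#) (Supported-mono proj₁ b-supp) (ε-Supported v e-supp) ,
    ∂b≈f
    where
    filled : Bounds (lk X v) s (ι v f)
    filled = acyc-lk s (ι v f) (ι-Supported v supp)
      (ι-Cycle v {f} cyc λ τ → ι-zero {v = v} {τ} {f = λ _ → 0#} λ _ → ≈-refl)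
    e = proj₁ filled
    e-supp = proj₁ (proj₂ filled)
    f′ = f ⊕ 1# · ∂ (ε v e)
    outside-v : Bounds (del X v) (suc s) f′
    outside-v = acyc (suc s) f′
      (del-Supported v (⊕-Supported 1# supp
        (∂-Supported down (ε-Supported v e-supp)))
        (ι-correct {X = X} v f e-supp (proj₂ (proj₂ filled))))
      (⊕-Cycle {f = f} {∂ (ε v e)} 1# cyc (∂² (ε v e)))
    b = proj₁ outside-v
    b-supp = proj₁ (proj₂ outside-v)
    ∂b≈f : ∂ (b ⊕ - 1# · ε v e) ≋ f
    ∂b≈f τ = begin
      ∂ (b ⊕ - 1# · ε v e) τ         ≈⟨ ∂-⊕ b (- 1#) (ε v e) τ ⟩
      ∂ b τ + - 1# * g               ≈⟨ +-cong (proj₂ (proj₂ outside-v) τ) (-1*x≈-x g) ⟩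
      (f τ + 1# * g) + - g           ≈⟨ +-congʳ (+-congˡ (*-identityˡ g)) ⟩
      (f τ + g) + - g                ≈⟨ +-assoc (f τ) g (- g) ⟩
      f τ + (g + - g)                ≈⟨ +-congˡ (-‿inverseʳ g) ⟩
      f τ + 0#                       ≈⟨ +-identityʳ (f τ) ⟩
      f τ                            ∎
      where g = ∂ (ε v e) τ

-- Deleting a cone from a homology sphere

module _ {n : ℕ} where

  dels : Faces n → List (Fin n) → Faces n
  dels X ws σ = X σ × All (_∉ σ) ws

  -- The clique condition in one-step form: two extensions of a face by adjacent vertices are
  -- compatible. This form passes to links directly.
  Flag : Faces n → Set
  Flag X = ∀ σ u v → X (σ ∪ ⁅ u ⁆) → X (σ ∪ ⁅ v ⁆) → X (⁅ u ⁆ ∪ ⁅ v ⁆) →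
           X ((σ ∪ ⁅ u ⁆) ∪ ⁅ v ⁆)

  dels-down : ∀ {X ws} → DownClosed X → DownClosed (dels X ws)
  dels-down down τ⊆σ (x , ws∉σ) = down τ⊆σ x , All.map (_∘ τ⊆σ) ws∉σ

  del-dels : ∀ X w (ws : List (Fin n)) → del (dels X ws) w ≐ dels X (w ∷ ws)
  del-dels X w ws σ = (λ ((x , a) , w∉) → x , w∉ ∷ a)
                    , (λ { (x , w∉ ∷ a) → (x , a) , w∉ })

  lk-dels : ∀ X w (ws : List (Fin n)) → All (w ≢_) ws →
            dels (lk X w) ws ≐ lk (dels X ws) w
  lk-dels X w ws w≢ws σ =
    (λ ((w∉ , x) , a) → w∉ , x ,
      All.zipWith (λ (u∉ , w≢u) → ∉-insert u∉ (w≢u ∘ ≡.sym)) (a , w≢ws)) ,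
    (λ (w∉ , x , a) → (w∉ , x) , All.map (_∘ p⊆p∪q ⁅ w ⁆) a)

  lk-flag : ∀ {X w} → DownClosed X → Flag X → Flag (lk X w)
  lk-flag {X} {w} down flag σ u v (w∉σu , x) (w∉σv , y) (_ , z) =
    (λ w∈ → [ w∉σu , w∉σv ∘ q⊆p∪q σ ⁅ v ⁆ ]′ (x∈p∪q⁻ _ ⁅ v ⁆ w∈)) ,
    ≡.subst X swap
      (flag (σ ∪ ⁅ w ⁆) u v (≡.subst X (∪-swap σ ⁅ u ⁆ ⁅ w ⁆) x)
            (≡.subst X (∪-swap σ ⁅ v ⁆ ⁅ w ⁆) y) (down (p⊆p∪q ⁅ w ⁆) z))
    where
    swap : ((σ ∪ ⁅ w ⁆) ∪ ⁅ u ⁆) ∪ ⁅ v ⁆ ≡ ((σ ∪ ⁅ u ⁆) ∪ ⁅ v ⁆) ∪ ⁅ w ⁆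
    swap = ≡.trans (≡.cong (_∪ ⁅ v ⁆) (∪-swap σ ⁅ w ⁆ ⁅ u ⁆))
                      (∪-swap (σ ∪ ⁅ u ⁆) ⁅ w ⁆ ⁅ v ⁆)

nonempty : ∀ {n k} {σ : Subset n} → ∣ σ ∣ ≡ suc k → Nonempty σ
nonempty {n} {σ = σ} eq with nonempty? σ
... | yes ne = ne
... | no ¬ne with ≡.trans (≡.sym (∣⊥∣≡0 n))
                   (≡.trans (≡.cong ∣_∣ (≡.sym (Empty-unique ¬ne))) eq)
...   | ()

module Spheres {c ℓ} (K : Field c ℓ) where
  open Field K hiding (zero; _-_) renaming (refl to ≈-refl; sym to ≈-sym; trans to ≈-trans)
  open Homology K
  open RingProperties ring
  open SetoidReasoning setoid
  open Operators K
  open Acyclicity K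

  private variable
    n d : ℕ
    X Y : Faces n

  -- The homological data of a Gorenstein* complex of dimension d - 1, with
  -- purity and the fact that the fundamental class ζ involves every vertex
  -- built in.
  record Sphere (d : ℕ) (X : Faces n) : Set (c ⊔ ℓ) where
    inductive
    field
      size≤    : ∀ {σ} → X σ → ∣ σ ∣ ≤ d
      topFace  : ∃ λ σ → X σ × ∣ σ ∣ ≡ d
      vanishes : ∀ {s} → s < d → Vanishes X s
      ζ        : Coeffs n
      ζ-supp   : Supported X d ζ
      ζ-cycle  : Cycle ζ
      ζ≉0      : ¬ ζ ≋0
      ζ-span   : ∀ w → Supported X d w → Cycle w → ∃ λ a → w ≋ λ σ → a * ζ σ
      ζ-vertex : ∀ {v} → X ⁅ v ⁆ → ¬ ι v ζ ≋0
      links    : ∀ {v} → X ⁅ v ⁆ → ∃ λ e → d ≡ suc e × Sphere e (lk X v)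

  open Sphere

  Sphere-≐ : X ≐ Y → Sphere d X → Sphere d Y
  links-≐ : ∀ v → X ≐ Y → (∃ λ e → d ≡ suc e × Sphere e (lk X v)) →
            ∃ λ e → d ≡ suc e × Sphere e (lk Y v)

  Sphere-≐ e S = record
    { size≤    = size≤ S ∘ proj₂ (e _)
    ; topFace  = let σ , x , eq = topFace S in σ , proj₁ (e σ) x , eq
    ; vanishes = Vanishes-≐ e ∘ vanishes S
    ; ζ        = ζ S
    ; ζ-supp   = Supported-mono (proj₁ (e _)) (ζ-supp S)
    ; ζ-cycle  = ζ-cycle S
    ; ζ≉0      = ζ≉0 S
    ; ζ-span   = λ w supp → ζ-span S w (Supported-mono (proj₂ (e _)) supp)
    ; ζ-vertex = ζ-vertex S ∘ proj₂ (e _)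
    ; links    = λ {v} y → links-≐ v e (links S (proj₂ (e _) y))
    }

  links-≐ v e (d , refl , L) = d , refl , Sphere-≐ (lk-≐ v e) L

  ι-0-Cycle : ∀ {f : Coeffs n} v → Cycle f → Cycle (ι v f)
  ι-0-Cycle {f = f} v cyc = ι-Cycle v {f} cyc
    λ τ → ι-zero {v = v} {τ} {f = λ _ → 0#} λ _ → ≈-refl

  -- `ι v (ζ S)` is a top cycle of the link, hence a multiple of the class there. A zero factor
  -- would contradict `ζ-vertex`, and a field inverts whatever is refutably zero.
  link-multiple : ∀ {e v} (S : Sphere (suc e) X) → X ⁅ v ⁆ →
    (L : Sphere e (lk X v)) → ∃ λ β → Unit β × ι v (ζ S) ≋ λ τ → β * ζ L τ
  link-multiple {v = v} S x L =
    let β , eq = ζ-span L (ι v (ζ S)) (ι-Supported v (ζ-supp S))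
                   (ι-0-Cycle {f = ζ S} v (ζ-cycle S))
    in β , inverse β (λ β≈0 → ζ-vertex S x λ τ →
         ≈-trans (eq τ) (≈-trans (*-congʳ β≈0) (zeroˡ _))) , eq

  -- From `¬ ζ ≋0` no nonzero coefficient can be extracted. Instead the equation is contracted along
  -- the vertices of a top face, each time losing a unit factor, down to dimension -1, where `ζ` has
  -- the single coefficient at `∅`.
  ζ-cancel : ∀ {a} → DownClosed X → (S : Sphere d X) →
             (∀ σ → a * ζ S σ ≈ 0#) → a ≈ 0#
  ζ-cancel {d = zero} down S aζ≈0 = unit-cancel (inverse (ζ S ∅) ζ∅≉0) (aζ≈0 ∅)
    where
    ζ∅≉0 : ¬ ζ S ∅ ≈ 0#
    ζ∅≉0 ζ∅≈0 = ζ≉0 S λ σ → case nonempty? σ of λ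
      { (yes (v , v∈σ)) → ζ-supp S σ λ (_ , eq) → ∣σ∣≡0⇒∉ eq v∈σ
      ; (no empty) → ≈-trans (reflexive (≡.cong (ζ S) (Empty-unique empty))) ζ∅≈0 }
  ζ-cancel {d = suc d} {a} down S aζ≈0
    with σ , xσ , eq ← topFace S
    with v , v∈σ ← nonempty eq
    with x ← down (⁅⁆-⊆ v∈σ) xσ
    with _ , refl , L ← links S x
    with β , β-unit , ιζ≈ ← link-multiple S x L =
    unit-cancel β-unit (ζ-cancel (lk-down down) L λ τ → begin
      (a * β) * ζ L τ    ≈⟨ *-assoc a β _ ⟩
      a * (β * ζ L τ)    ≈⟨ *-congˡ (ιζ≈ τ) ⟨
      a * ι v (ζ S) τ    ≈⟨ ι-· v a (ζ S) τ ⟨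
      ι v (λ σ → a * ζ S σ) τ  ≈⟨ ι-zero {f = λ σ → a * ζ S σ} (λ _ → aζ≈0 _) ⟩
      0#  ∎)

  -- By degree. Above the top there are no faces. In the top degree a cycle is `α` times the class,
  -- and avoiding `v` forces `α` to vanish. Below, a filling in `X` is pushed off `v`.
  delete-vertex : DownClosed X → Sphere d X → ∀ v → X ⁅ v ⁆ → Acyclic (del X v)
  delete-vertex {X = X} down S v x s f supp cyc
    with e , refl , L ← links S x
    with β , (β⁻¹ , ββ⁻¹≈1) , ιζ≈ ← link-multiple S x L
    with ℕₚ.<-cmp s (suc e)
  ... | tri> _ _ d<s = ≋0⇒Bounds λ σ → supp σ
        λ ((xσ , _) , eq) → ℕₚ.<⇒≱ d<s (≡.subst (_≤ suc e) eq (size≤ S xσ))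
  ... | tri≈ _ refl _ with α , f≈ ← ζ-span S f (Supported-mono proj₁ supp) cyc =
    ≋0⇒Bounds λ σ → ≈-trans (f≈ σ) (≈-trans (*-congʳ α≈0) (zeroˡ _))
    where
    α≈0 : α ≈ 0#
    α≈0 = unit-cancel (β⁻¹ , ββ⁻¹≈1) (ζ-cancel (lk-down down) L λ τ → begin
      (α * β) * ζ L τ          ≈⟨ *-assoc α β _ ⟩
      α * (β * ζ L τ)          ≈⟨ *-congˡ (ιζ≈ τ) ⟨
      α * ι v (ζ S) τ          ≈⟨ ι-· v α (ζ S) τ ⟨
      ι v (λ σ → α * ζ S σ) τ  ≈⟨ ι-cong {v = v} {f} f≈ τ ⟨
      ι v f τ                  ≈⟨ ι-del v supp τ ⟩
      0#                       ∎)
  ... | tri< (s≤s s≤e) _ _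
    with b , b-supp , ∂b ← vanishes S (s≤s s≤e) f (Supported-mono proj₁ supp) cyc
    with ιb-supp ← ι-Supported v b-supp
    with ιb-cycle ← ι-Cycle v {b} ∂b (ι-del v supp)
    with ℕₚ.m≤n⇒m<n∨m≡n s≤e
  ...   | inj₁ s<e = avoid v down supp (b , b-supp , ∂b)
          (vanishes L s<e (ι v b) ιb-supp ιb-cycle)
  -- One below the top, `ι v b` need not bound in the link, but it is `α` times the class there.
  -- Subtracting `α * β⁻¹` times `ζ S` from `b` cancels it and keeps the boundary.
  ...   | inj₂ refl with α , ιb≈ ← ζ-span L (ι v b) ιb-supp ιb-cycle =
    b ⊕ γ · ζ S ,
    del-Supported v (⊕-Supported γ b-supp (ζ-supp S)) ι≈0 ,
    λ τ → ≈-trans (∂-⊕-Cycle {f = b} {ζ S} γ (ζ-cycle S) τ) (∂b τ)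
    where
    γ = - (α * β⁻¹)
    ι≈0 : ι v (b ⊕ γ · ζ S) ≋0
    ι≈0 τ = begin
      ι v (b ⊕ γ · ζ S) τ               ≈⟨ ι-⊕ v b γ (ζ S) τ ⟩
      ι v b τ + γ * ι v (ζ S) τ         ≈⟨ +-cong (ιb≈ τ) (*-congˡ (ιζ≈ τ)) ⟩
      α * z + γ * (β * z)               ≈⟨ +-congˡ (*-assoc γ β z) ⟨
      α * z + (γ * β) * z               ≈⟨ +-congˡ (*-congʳ γβ≈-α) ⟩
      α * z + - α * z                   ≈⟨ +-congˡ (-‿distribˡ-* α z) ⟨
      α * z + - (α * z)                 ≈⟨ -‿inverseʳ _ ⟩
      0#                                ∎
      where
      z = ζ L τ
      γβ≈-α : γ * β ≈ - α
      γβ≈-α = begin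
        - (α * β⁻¹) * β    ≈⟨ -‿distribˡ-* (α * β⁻¹) β ⟨
        - ((α * β⁻¹) * β)  ≈⟨ -‿cong (*-assoc α β⁻¹ β) ⟩
        - (α * (β⁻¹ * β))  ≈⟨ -‿cong (*-congˡ (≈-trans (*-comm β⁻¹ β) ββ⁻¹≈1)) ⟩
        - (α * 1#)         ≈⟨ -‿cong (*-identityʳ α) ⟩
        - α                ∎

  -- The ws are deleted one by one; the link of w in what is left of X is a
  -- sphere from which the neighbours of w have been deleted, and these again
  -- form a cone with apex c.
  delete-cone : ∀ {c} (ws : List (Fin n)) → DownClosed X → Flag X →
    (∀ σ → Dec (X σ)) → Sphere d X → X ⁅ c ⁆ →
    (∀ {w} → w ∈ₗ ws → X ⁅ w ⁆ → w ≢ c → X (⁅ c ⁆ ∪ ⁅ w ⁆)) →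
    Acyclic (dels (del X c) ws)
  delete-cone {c = c} [] down flag X? S x adj =
    Acyclic-≐ (λ σ → (λ y → y , []) , proj₁) (delete-vertex down S c x)
  delete-cone {X = X} {c = c} (w ∷ ws) down flag X? S x adj =
    Acyclic-≐ (del-dels (del X c) w ws)
      (del-Acyclic w (dels-down (del-down down))
        (delete-cone ws down flag X? S x (adj ∘ there)) link-acyclic)
    where
    link-acyclic : Acyclic (lk (dels (del X c) ws) w)
    -- In the first three cases `w` is no vertex of what is left, so its link has no faces at all,
    -- not even `∅`.
    link-acyclic with w ≟ c | X? ⁅ w ⁆ | All.all? (λ u → ¬? (w ≟ u)) ws
    ... | yes refl | _ | _ = void-Acyclic λ σ (_ , (_ , w∉) , _) → w∉ ∈-insert
    ... | no _ | no ¬y | _ = void-Acyclic λ σ (_ , (y , _) , _) →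
      ¬y (down (q⊆p∪q σ ⁅ w ⁆) y)
    ... | no _ | yes _ | no ¬w≢ws = void-Acyclic λ σ (_ , _ , ws∉) →
      ¬w≢ws (All.map (λ u∉ → λ { refl → u∉ ∈-insert }) ws∉)
    ... | no w≢c | yes y | yes w≢ws with _ , _ , L ← links S y =
      Acyclic-≐ (≐-trans (λ σ → (λ ((z , c∉) , a) → proj₁ (e σ) (z , c∉) , a)
                               , (λ (z , a) → proj₂ (e σ) z , a))
                         (lk-dels (del X c) w ws w≢ws))
        (delete-cone ws (lk-down down) (lk-flag down flag)
          (λ σ → ¬? (w ∈? σ) ×-dec X? (σ ∪ ⁅ w ⁆)) L
          (w≢c ∘ x∈⁅y⁆⇒x≡y c , adj (here refl) y w≢c)
          adj′)
      where
      e : del (lk X w) c ≐ lk (del X c) w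
      e σ = (λ ((w∉ , z) , c∉) → w∉ , z , ∉-insert c∉ (w≢c ∘ ≡.sym))
          , (λ (w∉ , z , c∉) → (w∉ , z) , c∉ ∘ p⊆p∪q ⁅ w ⁆)
      adj′ : ∀ {u} → u ∈ₗ ws → lk X w ⁅ u ⁆ → u ≢ c → lk X w (⁅ c ⁆ ∪ ⁅ u ⁆)
      adj′ {u} u∈ (w∉u , z) u≢c =
        (λ w∈ → [ w≢c ∘ x∈⁅y⁆⇒x≡y c , w∉u ]′ (x∈p∪q⁻ ⁅ c ⁆ ⁅ u ⁆ w∈)) ,
        -- The edges `cw`, `cu` and `wu` span a triangle by flagness, so `c` is still adjacent to
        -- `u` inside the link of `w`.
        ≡.subst X (∪-swap ⁅ c ⁆ ⁅ w ⁆ ⁅ u ⁆)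
          (flag ⁅ c ⁆ w u (adj (here refl) y w≢c)
                (adj (there u∈) (down (p⊆p∪q ⁅ w ⁆) z) u≢c)
                (≡.subst X (∪-comm ⁅ u ⁆ ⁅ w ⁆) z))

-- Links of Gorenstein* complexes are homology spheres

-- Finitely many propositions may be assumed decided when the goal is a contradiction. This allows a
-- case split on the vertices that occur in the class.
¬¬-dec : ∀ {p m} {P : Fin m → Set p} → ¬ ¬ (∀ i → Dec (P i))
¬¬-dec {m = zero}  k = k λ ()
¬¬-dec {m = suc m} k = ¬¬-dec λ ds → ¬¬-excluded-middle λ d →
  k λ { zero → d ; (suc i) → ds i }

module FundamentalClass {c ℓ} (K : Field c ℓ) where
  open Field K hiding (zero; _-_) renaming (refl to ≈-refl; sym to ≈-sym; trans to ≈-trans)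
  open Homology K
  open RingProperties ring
  open SetoidReasoning setoid
  open Operators K
  open Acyclicity K
  open Spheres K
  open Sphere

  private variable
    n d : ℕ
    u v : Fin n
    σ : Subset n

  point : Fin n → Coeffs n
  point u σ = if does (≡-dec _≟ᵇ_ σ ⁅ u ⁆) then 1# else 0#

  point-≡ : σ ≡ ⁅ u ⁆ → point u σ ≈ 1#
  point-≡ {σ = σ} {u} eq with ≡-dec _≟ᵇ_ σ ⁅ u ⁆
  ... | yes _  = ≈-refl
  ... | no neq = contradiction eq neq

  point-≢ : σ ≢ ⁅ u ⁆ → point u σ ≈ 0#
  point-≢ {σ = σ} {u} neq with ≡-dec _≟ᵇ_ σ ⁅ u ⁆
  ... | yes eq = contradiction eq neq
  ... | no _   = ≈-refl

  ⁅⁆-injective : ⁅ u ⁆ ≡ ⁅ v ⁆ → u ≡ v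
  ⁅⁆-injective {u = u} {v} eq =
    x∈⁅y⁆⇒x≡y v (≡.subst (u ∈_) eq (x∈⁅x⁆ u))

  point-Supported : ∀ {X : Faces n} → X ⁅ u ⁆ → Supported X 1 (point u)
  point-Supported {u = u} x σ ¬x =
    point-≢ {σ = σ} λ { refl → ¬x (x , ∣⁅x⁆∣≡1 u) }

  -- The value of `∂` at `∅` is the augmentation of a 0-chain.
  ∂-point-∅ : ∀ (u : Fin n) → ∂ (point u) ∅ ≈ 1#
  ∂-point-∅ {n} u = begin
    ∂ (point u) ∅
      ≈⟨ sum-single (λ w → ι w (point u) ∅) u (λ w w≢u → ι-zero {v = w} {∅} {f = point u} λ _ →
           point-≢ (w≢u ∘ ⁅⁆-injective ∘ ≡.trans (≡.sym (∪-identityˡ ⁅ w ⁆)))) ⟩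
    ι u (point u) ∅                        ≈⟨ ι-∉ {f = point u} ∉⊥ ⟩
    sign (below u ∅) * point u (∅ ∪ ⁅ u ⁆)
      ≈⟨ *-cong (reflexive (≡.cong sign (≡.trans (≡.cong ∣_∣ (∩-zeroˡ (initial u)))
           (∣⊥∣≡0 n)))) (point-≡ (∪-identityˡ ⁅ u ⁆)) ⟩
    1# * 1#                                ≈⟨ *-identityˡ 1# ⟩
    1#                                     ∎

  difference : Fin n → Fin n → Coeffs n
  difference u v = point u ⊕ - 1# · point v

  difference-Cycle : ∀ (u v : Fin n) → Cycle (difference u v)
  difference-Cycle u v τ with nonempty? τ
  ... | no empty rewrite Empty-unique empty = begin
    ∂ (difference u v) ∅                   ≈⟨ ∂-⊕ (point u) (- 1#) (point v) ∅ ⟩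
    ∂ (point u) ∅ + - 1# * ∂ (point v) ∅
      ≈⟨ +-cong (∂-point-∅ u) (≈-trans (-1*x≈-x _) (-‿cong (∂-point-∅ v))) ⟩
    1# + - 1#                              ≈⟨ -‿inverseʳ 1# ⟩
    0#                                     ∎
  ... | yes (x , x∈τ) = ∂-zero {f = difference u v} λ w w∉τ →
    +-zero (point-≢ (two w∉τ)) (*-zero (point-≢ (two w∉τ)))
    where
    two : ∀ {w y} → w ∉ τ → τ ∪ ⁅ w ⁆ ≢ ⁅ y ⁆
    two {w} {y} w∉τ eq = w∉τ (≡.subst (_∈ τ)
      (≡.trans (x∈⁅y⁆⇒x≡y y (≡.subst (x ∈_) eq (p⊆p∪q ⁅ w ⁆ x∈τ)))
        (≡.sym (x∈⁅y⁆⇒x≡y y (≡.subst (w ∈_) eq (∈-insert {σ = τ}))))) x∈τ)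

  difference-at : u ≢ v → difference u v ⁅ u ⁆ ≈ 1#
  difference-at {u = u} u≢v = ≈-trans
    (+-cong (point-≡ {u = u} refl) (*-zero (point-≢ (u≢v ∘ ⁅⁆-injective))))
    (+-identityʳ 1#)

  module _ {p} {P : Fin n → Set p} (P? : Decidable P) where

    restrict : Coeffs n → Coeffs n
    restrict f σ = if does (Lift? P? σ) then f σ else 0#

    restrict-Lift : ∀ f → Lift P σ → restrict f σ ≈ f σ
    restrict-Lift {σ = σ} f lift with Lift? P? σ
    ... | yes _    = ≈-refl
    ... | no ¬lift = contradiction (λ {x} → lift {x}) ¬lift

    restrict-¬ : ∀ f {w} → w ∈ σ → ¬ P w → restrict f σ ≈ 0#
    restrict-¬ {σ = σ} f w∈σ ¬p with Lift? P? σ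
    ... | yes lift = contradiction (lift w∈σ) ¬p
    ... | no _     = ≈-refl

    -- If the difference of u and v were the boundary of a chain b, the restriction of
    -- b to the edges on which P holds would have the point u as its boundary.
    connected : ∀ {X : Faces n} →
      (∀ {v w} → X (⁅ v ⁆ ∪ ⁅ w ⁆) → P v → P w) →
      P u → ¬ P v → ¬ Bounds X 1 (difference u v)
    connected {u = u} {v} {X} P-edge pu ¬pv (b , b-supp , ∂b) = 0≉1 (begin
      0#                 ≈⟨ ∂² b′ ∅ ⟨
      ∂ (∂ b′) ∅         ≈⟨ sum-cong (λ w → ι-local {f = ∂ b′} {point u}
        (≡.subst (λ ρ → ∂ b′ ρ ≈ point u ρ) (≡.sym (∪-identityˡ ⁅ w ⁆)) (∂b′ w))) ⟩
      ∂ (point u) ∅      ≈⟨ ∂-point-∅ u ⟩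
      1#                 ∎)
      where
      b′ = restrict b
      ∂b′ : ∀ w → ∂ b′ ⁅ w ⁆ ≈ point u ⁅ w ⁆
      ∂b′ w with P? w
      ... | no ¬pw = ≈-trans
        (∂-zero {f = b′} λ x _ → restrict-¬ b (p⊆p∪q ⁅ x ⁆ (x∈⁅x⁆ w)) ¬pw)
        (≈-sym (point-≢ λ eq → ¬pw (≡.subst P (≡.sym (⁅⁆-injective eq)) pu)))
      ... | yes pw = begin
        ∂ b′ ⁅ w ⁆      ≈⟨ sum-cong (λ x → ι-local {f = b′} {b} (same x)) ⟩
        ∂ b ⁅ w ⁆       ≈⟨ ∂b ⁅ w ⁆ ⟩
        point u ⁅ w ⁆ + - 1# * point v ⁅ w ⁆
          ≈⟨ +-congˡ (*-zero (point-≢ λ eq → ¬pv (≡.subst P (⁅⁆-injective eq) pw))) ⟩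
        point u ⁅ w ⁆ + 0#  ≈⟨ +-identityʳ _ ⟩
        point u ⁅ w ⁆       ∎
        where
        same : ∀ x → b′ (⁅ w ⁆ ∪ ⁅ x ⁆) ≈ b (⁅ w ⁆ ∪ ⁅ x ⁆)
        same x with P? x
        ... | yes px = restrict-Lift b λ y∈ → [ (λ y∈w → ≡.subst P (≡.sym (x∈⁅y⁆⇒x≡y w y∈w)) pw)
                                     , (λ y∈x → ≡.subst P (≡.sym (x∈⁅y⁆⇒x≡y x y∈x)) px) ]′
                                       (x∈p∪q⁻ ⁅ w ⁆ ⁅ x ⁆ y∈)
        -- An edge from `w` satisfying `P` to `x` violating it is excluded by `P-edge`, so `b`
        -- vanishes there as well.
        ... | no ¬px = ≈-trans (restrict-¬ b (∈-insert {σ = ⁅ w ⁆}) ¬px)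
          (≈-sym (b-supp _ λ (e , _) → ¬px (P-edge e pw)))

  module _ {X : Faces n} (down : DownClosed X)
    (size≤ : ∀ {σ} → X σ → ∣ σ ∣ ≤ suc d)
    (van : ∀ {s} → s < suc d → Vanishes X s)
    (ζ : Coeffs n) (ζ-supp : Supported X (suc d) ζ) (ζ-cycle : Cycle ζ) (ζ≉0 : ¬ ζ ≋0)
    (ζ-span : ∀ w → Supported X (suc d) w → Cycle w → ∃ λ a → w ≋ λ σ → a * ζ σ)
    (spheres : ∀ {v} → X ⁅ v ⁆ → ∃ λ e → Sphere e (lk X v))
    where

    link-dim : ∀ {e} → Sphere e (lk X v) → ¬ ι v ζ ≋0 → d ≡ e
    link-dim {v = v} {e} L ιζ≉0
      with σ , (v∉σ , x) , refl ← topFace L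
      with ℕₚ.m≤n⇒m<n∨m≡n (ℕ.s≤s⁻¹ (≡.subst (_≤ suc d) (∣insert∣ v∉σ) (size≤ x)))
    ... | inj₂ e≡d = ≡.sym e≡d
    ... | inj₁ e<d = contradiction
      (λ τ → ι-Supported v ζ-supp τ λ (y , eq) →
        ℕₚ.<⇒≱ e<d (≡.subst (_≤ ∣ σ ∣) eq (Sphere.size≤ L y)))
      ιζ≉0

    -- If ζ involved w, then ι w ζ would be a unit multiple of the fundamental
    -- class of the link of w, which involves v; but ι v and ι w anticommute.
    edge : ∀ {v w} → X (⁅ v ⁆ ∪ ⁅ w ⁆) → ι v ζ ≋0 → ¬ ¬ ι w ζ ≋0
    edge {v} {w} x ιvζ≈0 ιwζ≉0 with v ≟ w
    ... | yes refl = ιwζ≉0 ιvζ≈0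
    ... | no v≢w
      with e , L ← spheres (down (q⊆p∪q ⁅ v ⁆ ⁅ w ⁆) x)
      with refl ← link-dim L ιwζ≉0
      with β , ιwζ≈ ← Sphere.ζ-span L (ι w ζ) (ι-Supported w ζ-supp) (ι-0-Cycle {f = ζ} w ζ-cycle)
      with β⁻¹ , eq ← inverse β (λ β≈0 → ιwζ≉0 λ τ →
             ≈-trans (ιwζ≈ τ) (≈-trans (*-congʳ β≈0) (zeroˡ _)))
      = Sphere.ζ-vertex L (v≢w ∘ ≡.sym ∘ x∈⁅y⁆⇒x≡y v , x) λ τ →
          unit-cancel (β⁻¹ , eq) (≈-trans (*-comm _ β) (begin
            β * ι v (Sphere.ζ L) τ          ≈⟨ ι-· v β (Sphere.ζ L) τ ⟨
            ι v (λ σ → β * Sphere.ζ L σ) τ  ≈⟨ ι-cong {v = v} {ι w ζ} ιwζ≈ τ ⟨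
            ι v (ι w ζ) τ                   ≈⟨ +-identityʳ _ ⟨
            ι v (ι w ζ) τ + 0#              ≈⟨ +-congˡ (ι-zero {f = ι v ζ} λ _ → ιvζ≈0 _) ⟨
            ι v (ι w ζ) τ + ι w (ι v ζ) τ   ≈⟨ ι-anticomm v w ζ τ ⟩
            0#                              ∎))

    -- By `edge`, the vertices missing from `ζ` are closed under adjacency. In positive dimension
    -- the vanishing of reduced degree 0 homology makes the complex connected, so they cannot be a
    -- proper nonempty part of the vertices.
    not-separated : ∀ {u v} → X ⁅ u ⁆ → X ⁅ v ⁆ → (∀ w → Dec (ι w ζ ≋0)) →
                    ι u ζ ≋0 → ¬ ¬ ι v ζ ≋0
    not-separated {u} {v} x y ζ? ιuζ≈0 ιvζ≉0 = by-dim d refl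
      where
      u≢v : u ≢ v
      u≢v refl = ιvζ≉0 ιuζ≈0
      supp : Supported X 1 (difference u v)
      supp = ⊕-Supported (- 1#) (point-Supported x) (point-Supported y)
      by-dim : ∀ k → d ≡ k → ⊥
      by-dim (suc k) refl = connected ζ?
        (λ {v} {w} e ιvζ≈0 → decidable-stable (ζ? w) (edge e ιvζ≈0))
        ιuζ≈0 ιvζ≉0 (van (s≤s (s≤s z≤n)) (difference u v) supp (difference-Cycle u v))
      -- In dimension 0 the difference of the two points is itself a top cycle, hence a multiple of
      -- `ζ`; but `ζ` is zero at `u` and the difference is not.
      by-dim zero refl with a , eq ← ζ-span (difference u v) supp (difference-Cycle u v) =
        0≉1 (begin
          0#                    ≈⟨ *-zero (ι-detects {f = ζ} (x∈⁅x⁆ u) (ιuζ≈0 _)) ⟨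
          a * ζ ⁅ u ⁆           ≈⟨ eq ⁅ u ⁆ ⟨
          difference u v ⁅ u ⁆  ≈⟨ difference-at u≢v ⟩
          1#                    ∎)

    -- If one vertex is missing from `ζ` then every vertex is, and `ζ` would be zero.
    full-support : ∀ {u} → X ⁅ u ⁆ → ¬ ι u ζ ≋0
    full-support {u} x ιuζ≈0 = ¬¬-dec λ ζ? → ζ≉0 λ σ → case nonempty? σ of λ
      { (no empty) → ζ-supp σ λ (_ , eq) → empty (nonempty eq)
      ; (yes (v , v∈σ)) → ι-detects {f = ζ} v∈σ (case ζ? v of λ
          { (yes ιvζ≈0) → ιvζ≈0 (σ - v)
          ; (no ιvζ≉0)  → ι-Supported v ζ-supp (σ - v) λ ((_ , y) , _) →
              not-separated x (down (q⊆p∪q (σ - v) ⁅ v ⁆) y) ζ? ιuζ≈0 ιvζ≉0 }) }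

-- Boolean complexes and their links

Face : ∀ {n} → Complex n → Faces n
Face Δ σ = Δ σ ≡ true

Disjoint : ∀ {n} → Subset n → Subset n → Set
Disjoint σ τ = ∀ {v} → v ∈ σ → v ∉ τ

∧⁻ : ∀ {a b} → a ∧ b ≡ true → a ≡ true × b ≡ true
∧⁻ {true} {true} refl = refl , refl

∧⁺ : ∀ {a b} → a ≡ true → b ≡ true → a ∧ b ≡ true
∧⁺ refl refl = refl

module _ {n : ℕ} where

  private variable
    F σ τ : Subset n
    v : Fin n

  Disjoint⁺ : (∣ σ ∩ τ ∣ ≡ᵇ 0) ≡ true → Disjoint σ τ
  Disjoint⁺ eq v∈σ v∈τ =
    ∣σ∣≡0⇒∉ (ℕₚ.≡ᵇ⇒≡ _ 0 (≡true⇒T eq)) (x∈p∩q⁺ (v∈σ , v∈τ))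

  Disjoint⁻ : Disjoint σ τ → (∣ σ ∩ τ ∣ ≡ᵇ 0) ≡ true
  Disjoint⁻ {σ} {τ} disj = T⇒≡true (ℕₚ.≡⇒≡ᵇ _ 0 (≡.trans
    (≡.cong ∣_∣ (Empty-unique λ (v , v∈) → let v∈σ , v∈τ = x∈p∩q⁻ σ τ v∈ in disj v∈σ v∈τ))
    (∣⊥∣≡0 n)))

  link⁺ : ∀ {Δ} → Disjoint σ F → Face Δ (σ ∪ F) → Face (link Δ F) σ
  link⁺ disj x = ∧⁺ (Disjoint⁻ disj) x

  link⁻ : ∀ {Δ} → Face (link Δ F) σ → Disjoint σ F × Face Δ (σ ∪ F)
  link⁻ {F} {σ} x =
    let disj , y = ∧⁻ x in Disjoint⁺ {σ} {F} disj , y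

  ∪-rotate : ∀ (σ τ ρ : Subset n) → (σ ∪ τ) ∪ ρ ≡ σ ∪ (ρ ∪ τ)
  ∪-rotate σ τ ρ = ≡.trans (∪-assoc σ τ ρ) (≡.cong (σ ∪_) (∪-comm τ ρ))

  module _ {Δ : Complex n} (down : DownClosed (Face Δ)) where

    link-down : DownClosed (Face (link Δ F))
    link-down {F} τ⊆σ x = let disj , y = link⁻ {Δ = Δ} x in
      link⁺ {Δ = Δ} (disj ∘ τ⊆σ) (down (∪-monoˡ-⊆ τ⊆σ) y)

    link-∅ : Face Δ F → Face (link Δ F) ∅
    link-∅ {F} x = link⁺ {Δ = Δ} (λ v∈ → contradiction v∈ ∉⊥)
      (≡.subst (Face Δ) (≡.sym (∪-identityˡ F)) x)

    link-vertex⁺ : v ∉ F → Face Δ (F ∪ ⁅ v ⁆) → Face (link Δ F) ⁅ v ⁆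
    link-vertex⁺ {v} {F} v∉F x = link⁺ {Δ = Δ}
      (λ u∈v u∈F → v∉F (≡.subst (_∈ F) (x∈⁅y⁆⇒x≡y v u∈v) u∈F))
      (≡.subst (Face Δ) (∪-comm F ⁅ v ⁆) x)

    link-vertex⁻ : Face (link Δ F) ⁅ v ⁆ → v ∉ F × Face Δ (F ∪ ⁅ v ⁆)
    link-vertex⁻ {F} {v} x = let disj , y = link⁻ {Δ = Δ} x in
      disj (x∈⁅x⁆ v) , ≡.subst (Face Δ) (∪-comm ⁅ v ⁆ F) y

    lk-link : v ∉ F → lk (Face (link Δ F)) v ≐ Face (link Δ (F ∪ ⁅ v ⁆))
    lk-link {v} {F} v∉F τ = to , from
      where
      to : lk (Face (link Δ F)) v τ → Face (link Δ (F ∪ ⁅ v ⁆)) τ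
      to (v∉τ , x) = let disj , y = link⁻ {Δ = Δ} x in link⁺ {Δ = Δ}
        (λ u∈τ → ∉-insert (disj (p⊆p∪q ⁅ v ⁆ u∈τ)) λ { refl → v∉τ u∈τ })
        (≡.subst (Face Δ) (∪-rotate τ ⁅ v ⁆ F) y)
      from : Face (link Δ (F ∪ ⁅ v ⁆)) τ → lk (Face (link Δ F)) v τ
      from x = let disj , y = link⁻ {Δ = Δ} x in
        (λ v∈τ → disj v∈τ ∈-insert) ,
        link⁺ {Δ = Δ}
          (λ u∈ u∈F → [ (λ u∈τ → disj u∈τ (p⊆p∪q ⁅ v ⁆ u∈F))
                      , (λ u∈v → v∉F (≡.subst (_∈ F) (x∈⁅y⁆⇒x≡y v u∈v) u∈F)) ]′
                      (x∈p∪q⁻ τ ⁅ v ⁆ u∈))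
          (≡.subst (Face Δ) (≡.sym (∪-rotate τ ⁅ v ⁆ F)) y)

    module _ (flag : Flag (Face Δ)) where

      link-flag : Flag (Face (link Δ F))
      link-flag {F} σ u v x y z
        with disj-u , x′ ← link⁻ {Δ = Δ} x
           | disj-v , y′ ← link⁻ {Δ = Δ} y
           | _ , z′ ← link⁻ {Δ = Δ} z =
        link⁺ {Δ = Δ}
          (λ w∈ → [ disj-u , disj-v ∘ q⊆p∪q σ ⁅ v ⁆ ]′ (x∈p∪q⁻ (σ ∪ ⁅ u ⁆) ⁅ v ⁆ w∈))
          (≡.subst (Face Δ)
            (≡.trans (≡.cong (_∪ ⁅ v ⁆) (∪-swap σ F ⁅ u ⁆)) (∪-swap (σ ∪ ⁅ u ⁆) F ⁅ v ⁆))
            (flag (σ ∪ F) u v (≡.subst (Face Δ) (∪-swap σ ⁅ u ⁆ F) x′)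
                  (≡.subst (Face Δ) (∪-swap σ ⁅ v ⁆ F) y′)
                  (down (p⊆p∪q F) z′)))

      link-edge : ∀ {u} → u ∉ F → v ∉ F → Face Δ (F ∪ ⁅ u ⁆) → Face Δ (F ∪ ⁅ v ⁆) →
        Face Δ (⁅ u ⁆ ∪ ⁅ v ⁆) → Face (link Δ F) (⁅ u ⁆ ∪ ⁅ v ⁆)
      link-edge {F} {v} {u} u∉F v∉F xu xv uv = link⁺ {Δ = Δ}
        (λ w∈ w∈F → [ (λ w∈u → u∉F (≡.subst (_∈ F) (x∈⁅y⁆⇒x≡y u w∈u) w∈F))
                    , (λ w∈v → v∉F (≡.subst (_∈ F) (x∈⁅y⁆⇒x≡y v w∈v) w∈F)) ]′
                    (x∈p∪q⁻ ⁅ u ⁆ ⁅ v ⁆ w∈))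
        (≡.subst (Face Δ)
          (≡.trans (∪-assoc F ⁅ u ⁆ ⁅ v ⁆) (∪-comm F (⁅ u ⁆ ∪ ⁅ v ⁆)))
          (flag F u v xu xv uv))

  maxFaceSize : ∀ {Δ : Complex n} → Face Δ σ → ∃ (MaxFaceSize Δ)
  maxFaceSize {σ} {Δ} x = search n λ τ _ → ∣p∣≤n τ
    where
    search : ∀ k → (∀ τ → Face Δ τ → ∣ τ ∣ ≤ k) → ∃ (MaxFaceSize Δ)
    search k bound
      with anySubset? (λ τ → (Δ τ ≟ᵇ true) ×-dec (∣ τ ∣ ℕₚ.≟ k))
    ... | yes top = k , top , bound
    search zero bound | no ¬top =
      contradiction (σ , x , ℕₚ.n≤0⇒n≡0 (bound σ x)) ¬top
    search (suc k) bound | no ¬top = search k λ τ y →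
      ℕ.s≤s⁻¹ (ℕₚ.≤∧≢⇒< (bound τ y) λ eq → ¬top (τ , y , eq))

module GorensteinLinks {c ℓ} (K : Field c ℓ) where
  open Field K hiding (zero; _-_) renaming (refl to ≈-refl; sym to ≈-sym; trans to ≈-trans)
  open Homology K
  open RingProperties ring
  open Operators K
  open Acyclicity K
  open Spheres K
  open FundamentalClass K

  module _ {n : ℕ} {Δ : Complex n} where

    toChain : ∀ {s f} → Supported (Face Δ) s f → Chain Δ s
    toChain {s} {f} supp = record
      { coeff   = f
      ; support = λ σ eq → supp σ λ { (x , refl) → case
          ≡.trans (≡.sym eq) (∧⁺ x (T⇒≡true (ℕₚ.≡⇒≡ᵇ ∣ σ ∣ s refl))) of λ () } }

    fromChain : ∀ {s} (z : Chain Δ s) → Supported (Face Δ) s (coeff z)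
    fromChain {s} z σ ¬x with Δ σ in x | ∣ σ ∣ ≡ᵇ s in eq
    ... | true  | true  = contradiction (refl , ℕₚ.≡ᵇ⇒≡ _ _ (≡true⇒T eq)) ¬x
    ... | true  | false = support z σ (≡.cong₂ _∧_ x eq)
    ... | false | _     = support z σ (≡.cong (_∧ _) x)

    toVanishes : ∀ {s} → HomologyVanishes Δ s → Vanishes (Face Δ) s
    toVanishes van f supp cyc =
      let b , ∂b = van (toChain supp) cyc in coeff b , fromChain b , ∂b

    fromVanishes : ∀ {s} → Vanishes (Face Δ) s → HomologyVanishes Δ s
    fromVanishes van z cyc =
      let b , supp , ∂b = van (coeff z) (fromChain z) cyc in toChain supp , ∂b

  module _ {n : ℕ} {Δ : Complex n} (down : DownClosed (Face Δ)) (G : Gorenstein* Δ) where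

    -- The homology is given by the Gorenstein* condition at `F`. The link of a vertex is the link
    -- of a larger face, with strictly smaller `e`, so it is a sphere by induction; purity and
    -- `ζ-vertex` then follow from `link-dim` and `full-support`.
    link-sphere-step : ∀ {F d} → Face Δ F → MaxFaceSize (link Δ F) d →
      (∀ {F′ e} → e < d → Face Δ F′ → MaxFaceSize (link Δ F′) e →
        Sphere e (Face (link Δ F′))) →
      Sphere d (Face (link Δ F))
    link-sphere-step {F} {d} x max@(top , size≤) rec
      with z , z-cycle , z-nonzero , z-span ← proj₂ G F x d max = record
      { size≤    = λ {σ} → size≤ σ
      ; topFace  = top
      ; vanishes = vanishes
      ; ζ        = coeff z
      ; ζ-supp   = fromChain z
      ; ζ-cycle  = z-cycle
      ; ζ≉0      = nonzero
      ; ζ-span   = span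
      ; ζ-vertex = λ y → proj₁ (vertex y (proj₂ (positive y)))
      ; links    = λ y → proj₂ (vertex y (proj₂ (positive y)))
      }
      where
      X = Face (link Δ F)

      vanishes : ∀ {s} → s < d → Vanishes X s
      vanishes s<d = toVanishes (proj₁ G F x d max _ s<d)

      nonzero : ¬ coeff z ≋0
      nonzero z≈0 = z-nonzero (toChain (λ _ _ → ≈-refl) , proj₂ (proj₂ (≋0⇒Bounds {X = X} {d} z≈0)))

      span : ∀ w → Supported X d w → Cycle w → ∃ λ a → w ≋ λ σ → a * coeff z σ
      span w supp cyc with a , b , ∂b ← z-span (toChain supp) cyc =
        -- In the top degree homologous cycles are equal: the bounding chain has size `suc d`, and
        -- there are no faces of that size.
        a , λ σ → x∙y⁻¹≈ε⇒x≈y _ _ (≈-trans (≈-sym (∂b σ))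
          (∂-zero {f = coeff b} λ v _ → fromChain b _ λ (y , eq) →
            ℕₚ.<-irrefl refl (≡.subst (_≤ d) eq (size≤ _ y))))

      spheres : ∀ {v} → X ⁅ v ⁆ → ∃ λ e → Sphere e (lk X v)
      spheres {v} y
        with v∉F , y′ ← link-vertex⁻ {Δ = Δ} down y
        with e , max′@((σ , xσ , refl) , _) ← maxFaceSize (link-∅ {Δ = Δ} down y′)
        with v∉σ , xσv ← proj₂ (lk-link {Δ = Δ} down v∉F σ) xσ =
        e , Sphere-≐ (≐-sym (lk-link {Δ = Δ} down v∉F))
          (rec (≡.subst (_≤ d) (∣insert∣ v∉σ) (size≤ _ xσv)) y′ max′)

      positive : ∀ {v} → X ⁅ v ⁆ → ∃ λ e → d ≡ suc e
      positive {v} y with s≤s {n = e} _ ← ≡.subst (_≤ d) (∣⁅x⁆∣≡1 v) (size≤ _ y) =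
        e , refl

      vertex : ∀ {v d′} → X ⁅ v ⁆ → d ≡ suc d′ →
        ¬ ι v (coeff z) ≋0 × ∃ λ e → d ≡ suc e × Sphere e (lk X v)
      vertex {v} y refl =
        let e , L = spheres y
        in ιz≉0 , e , ≡.cong suc (link-dim X-down size≤′ vanishes (coeff z)
             (fromChain z) z-cycle nonzero span spheres L ιz≉0) , L
        where
        X-down : DownClosed X
        X-down = link-down {Δ = Δ} down
        size≤′ : ∀ {σ} → X σ → ∣ σ ∣ ≤ d
        size≤′ {σ} = size≤ σ
        ιz≉0 : ¬ ι v (coeff z) ≋0
        ιz≉0 = full-support X-down size≤′ vanishes (coeff z) (fromChain z) z-cycle
          nonzero span spheres y

    link-sphere : ∀ {F} → Face Δ F → ∃ λ d → Sphere d (Face (link Δ F))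
    link-sphere {F} x =
      let d , max = maxFaceSize (link-∅ {Δ = Δ} down x) in d , go d F x max
      where
      go : ∀ d F → Face Δ F → MaxFaceSize (link Δ F) d → Sphere d (Face (link Δ F))
      go = <-rec _ λ d rec F x max →
        link-sphere-step x max λ e<d → rec e<d _

-- Faces with at most one vertex in a given set

module _ {n : ℕ} where

  elements : Subset n → List (Fin n)
  elements I = filter (_∈? I) (List.allFin n)

  ∈-elements⁺ : ∀ {I w} → w ∈ I → w ∈ₗ elements I
  ∈-elements⁺ {I} {w} = ∈-filter⁺ (_∈? I) (∈-allFin w)

  ∈-elements⁻ : ∀ {I w} → w ∈ₗ elements I → w ∈ I
  ∈-elements⁻ {I} w∈ = proj₂ (∈-filter⁻ (_∈? I) {xs = List.allFin n} w∈)

  dels-⊆ : ∀ {I ws σ} {X : Faces n} → (∀ {w} → w ∈ₗ ws → w ∈ I) →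
           X σ → Disjoint σ I → dels X ws σ
  dels-⊆ ws⊆I x disj = x , All.tabulate λ w∈ws w∈σ → disj w∈σ (ws⊆I w∈ws)

  dels-elements⁺ : ∀ {I σ} {X : Faces n} → X σ → Disjoint σ I → dels X (elements I) σ
  dels-elements⁺ {X = X} = dels-⊆ {X = X} ∈-elements⁻

  dels-elements⁻ : ∀ {I σ} {X : Faces n} → dels X (elements I) σ → Disjoint σ I
  dels-elements⁻ (_ , a) v∈σ v∈I = All.lookup a (∈-elements⁺ v∈I) v∈σ

  AtMostOne : Subset n → Subset n → Set
  AtMostOne I σ = ∀ {u v} → u ∈ σ → v ∈ σ → u ∈ I → v ∈ I → u ≡ v

-- The hypothesis `apex` says that the vertices of `I` in the link of `F` in `Δ`, if there are any,
-- have one among them adjacent to all the others.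
module Sparse {c ℓ} (K : Field c ℓ) {n : ℕ} {Δ Γ : Complex n}
  (down : DownClosed (Face Δ)) (flag : Flag (Face Δ)) (G : Homology.Gorenstein* K Δ)
  (I : Subset n)
  (sparse : Face Γ ≐ λ σ → Face Δ σ × AtMostOne I σ)
  (apex : ∀ {F w} → Face Γ F → w ∈ I → w ∉ F → Face Δ (F ∪ ⁅ w ⁆) →
    ∃ λ a → a ∈ I × a ∉ F × Face Δ (F ∪ ⁅ a ⁆) ×
      (∀ {u} → u ∈ I → u ∉ F → Face Δ (F ∪ ⁅ u ⁆) → Face Δ (⁅ a ⁆ ∪ ⁅ u ⁆)))
  where
  open Acyclicity K
  open Spheres K
  open GorensteinLinks K

  private variable
    F : Subset n

  Γ⁺ : ∀ {σ} → Face Δ σ → AtMostOne I σ → Face Γ σ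
  Γ⁺ x amo = proj₂ (sparse _) (x , amo)

  Γ⇒Δ : ∀ {σ} → Face Γ σ → Face Δ σ
  Γ⇒Δ x = proj₁ (proj₁ (sparse _) x)

  Γ⇒AtMostOne : ∀ {σ} → Face Γ σ → AtMostOne I σ
  Γ⇒AtMostOne x = proj₂ (proj₁ (sparse _) x)

  Γ-down : DownClosed (Face Γ)
  Γ-down τ⊆σ x = Γ⁺ (down τ⊆σ (Γ⇒Δ x))
    λ u∈ v∈ → Γ⇒AtMostOne x (τ⊆σ u∈) (τ⊆σ v∈)

  avoiding-Acyclic : ∀ {w} → Face Γ F → w ∈ I → w ∉ F → Face Δ (F ∪ ⁅ w ⁆) →
                     Acyclic (dels (Face (link Δ F)) (elements I))
  avoiding-Acyclic {F} x w∈I w∉F xw with a , a∈I , a∉F , xa , adj ← apex x w∈I w∉F xw =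
    -- `delete-cone` deletes the apex separately; as `a` lies in `I`, it is among the deleted
    -- elements anyway.
    Acyclic-≐ (λ σ → (λ ((y , _) , avoid) → y , avoid)
                   , (λ (y , avoid) → (y , λ a∈σ →
                        dels-elements⁻ {X = Face (link Δ F)} (y , avoid) a∈σ a∈I) , avoid))
      (delete-cone (elements I) (link-down {Δ = Δ} down)
        (link-flag {Δ = Δ} down flag)
        (λ σ → link Δ F σ ≟ᵇ true) (proj₂ (link-sphere down G (Γ⇒Δ x)))
        (link-vertex⁺ {Δ = Δ} down a∉F xa)
        (λ u∈ y _ → adjacent (∈-elements⁻ u∈) (link-vertex⁻ {Δ = Δ} down y)))
    where
    adjacent : ∀ {u} → u ∈ I → u ∉ F × Face Δ (F ∪ ⁅ u ⁆) →
               Face (link Δ F) (⁅ a ⁆ ∪ ⁅ u ⁆)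
    adjacent u∈I (u∉F , xu) = link-edge {Δ = Δ} down flag a∉F u∉F xa xu (adj u∈I u∉F xu)

  link-Γ⊆Δ : ∀ {σ} → Face (link Γ F) σ → Face (link Δ F) σ
  link-Γ⊆Δ x = let disj , y = link⁻ {Δ = Γ} x in link⁺ {Δ = Δ} disj (Γ⇒Δ y)

  avoiding-link : ∀ {σ} → Face Γ F → Face (link Δ F) σ → Disjoint σ I →
                  Face (link Γ F) σ
  avoiding-link {F} {σ} x y avoid = let disj , z = link⁻ {Δ = Δ} y in
    link⁺ {Δ = Γ} disj (Γ⁺ z λ u∈ v∈ u∈I v∈I →
      Γ⇒AtMostOne x (in-F u∈ u∈I) (in-F v∈ v∈I) u∈I v∈I)
    where
    in-F : ∀ {u} → u ∈ σ ∪ F → u ∈ I → u ∈ F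
    in-F u∈ u∈I = [ (λ u∈σ → contradiction u∈I (avoid u∈σ)) , id ]′ (x∈p∪q⁻ σ F u∈)

  -- `F` already contains the one element of `I` allowed, so faces of its link in `Γ` can have none.
  occupied-link : ∀ {i} → Face Γ F → i ∈ F → i ∈ I →
                  Face (link Γ F) ≐ dels (Face (link Δ F)) (elements I)
  occupied-link {F} {i} x i∈F i∈I σ =
    (λ y → let disj , z = link⁻ {Δ = Γ} y in
      dels-elements⁺ {X = Face (link Δ F)} (link-Γ⊆Δ y) λ u∈σ u∈I →
        disj u∈σ (≡.subst (_∈ F)
          (Γ⇒AtMostOne z (q⊆p∪q σ F i∈F) (p⊆p∪q F u∈σ) i∈I u∈I) i∈F)) ,
    (λ y → avoiding-link x (proj₁ y) (dels-elements⁻ {X = Face (link Δ F)} y))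

  -- Either alternative gives the vanishing below the top: inherited from `Δ`, or in all degrees.
  Dichotomy : Subset n → Set _
  Dichotomy F = (Face (link Γ F) ≐ Face (link Δ F)) ⊎ Acyclic (Face (link Γ F))

  IVertex : Subset n → Fin n → Set
  IVertex F w = w ∈ I × Face (link Δ F) ⁅ w ⁆

  IVertex? : ∀ F w → Dec (IVertex F w)
  IVertex? F w = (w ∈? I) ×-dec (link Δ F ⁅ w ⁆ ≟ᵇ true)

  occupied : ∀ {i} → Face Γ F → i ∈ F → i ∈ I → Dichotomy F
  occupied {F} x i∈F i∈I with any? (IVertex? F)
  ... | yes (w , w∈I , y) = let w∉F , xw = link-vertex⁻ {Δ = Δ} down y in
    inj₂ (Acyclic-≐ (≐-sym (occupied-link x i∈F i∈I)) (avoiding-Acyclic x w∈I w∉F xw))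
  ... | no none = inj₁ λ σ → link-Γ⊆Δ , λ y → avoiding-link x y
    λ {v} v∈σ v∈I → none (v , v∈I , link-down {Δ = Δ} down (⁅⁆-⊆ v∈σ) y)

  module _ (x : Face Γ F) (free : Disjoint F I)
    {p q : Fin n} (pI : IVertex F p) (qI : IVertex F q) (p≢q : p ≢ q) where

    -- A vertex of I has a neighbour in I, because I is a cone with at least two
    -- vertices in the link of F.
    neighbour : ∀ {w} → w ∈ I → w ∉ F → Face Δ (F ∪ ⁅ w ⁆) →
      ∃ λ u → u ∈ I × u ∉ F ∪ ⁅ w ⁆ × Face Δ ((F ∪ ⁅ w ⁆) ∪ ⁅ u ⁆)
    neighbour {w} w∈I w∉F xw with a , a∈I , a∉F , xa , adj ← apex x w∈I w∉F xw with a ≟ w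
    ... | no a≢w = a , a∈I , ∉-insert a∉F a≢w ,
      flag F w a xw xa (≡.subst (Face Δ) (∪-comm ⁅ a ⁆ ⁅ w ⁆) (adj w∈I w∉F xw))
    ... | yes refl = case p ≟ w of λ
      { (no p≢w)   → other pI p≢w
      ; (yes refl) → other qI (p≢q ∘ ≡.sym) }
      where
      other : ∀ {u} → IVertex F u → u ≢ w →
        ∃ λ u → u ∈ I × u ∉ F ∪ ⁅ w ⁆ × Face Δ ((F ∪ ⁅ w ⁆) ∪ ⁅ u ⁆)
      other {u} (u∈I , y) u≢w = let u∉F , xu = link-vertex⁻ {Δ = Δ} down y in
        u , u∈I , ∉-insert u∉F u≢w , flag F w u xw xu (adj u∈I u∉F xu)

    -- Joining `w` to `F` makes the face occupied, so its link in `Γ` avoids `I` and deleting `ws`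
    -- changes nothing. `neighbour` provides the vertex of `I` that `avoiding-Acyclic` asks for.
    link-vertex-Acyclic : ∀ {w ws} → w ∈ I → (∀ {u} → u ∈ₗ ws → u ∈ I) →
                          Acyclic (lk (dels (Face (link Γ F)) ws) w)
    link-vertex-Acyclic {w} {ws} w∈I ws⊆I
      with All.all? (λ u → ¬? (w ≟ u)) ws | link Γ F ⁅ w ⁆ ≟ᵇ true
    ... | no ¬w≢ws | _ = void-Acyclic λ σ (_ , _ , ws∉) →
      ¬w≢ws (All.map (λ u∉ → λ { refl → u∉ ∈-insert }) ws∉)
    ... | yes _ | no ¬y = void-Acyclic λ σ (_ , y , _) →
      ¬y (link-down {Δ = Γ} Γ-down (q⊆p∪q σ ⁅ w ⁆) y)
    ... | yes w≢ws | yes y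
      with w∉F , xw ← link-vertex⁻ {Δ = Γ} Γ-down y
      with u , u∈I , u∉ , xwu ← neighbour w∈I w∉F (Γ⇒Δ xw) =
      Acyclic-≐ (≐-trans reduce (lk-dels (Face (link Γ F)) w ws w≢ws))
        (avoiding-Acyclic xw u∈I u∉ xwu)
      where
      X = Face (link Δ (F ∪ ⁅ w ⁆))
      occ : Face (link Γ (F ∪ ⁅ w ⁆)) ≐ dels X (elements I)
      occ = occupied-link xw ∈-insert w∈I
      reduce : dels X (elements I) ≐ dels (lk (Face (link Γ F)) w) ws
      reduce σ =
        (λ z → dels-⊆ {X = lk (Face (link Γ F)) w} ws⊆I
                 (proj₂ (lk-link {Δ = Γ} Γ-down w∉F σ) (proj₂ (occ σ) z))
                 (dels-elements⁻ {X = X} z)) ,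
        (λ (z , _) → proj₁ (occ σ) (proj₁ (lk-link {Δ = Γ} Γ-down w∉F σ) z))

    restore : ∀ ws → (∀ {u} → u ∈ₗ ws → u ∈ I) →
      Acyclic (dels (Face (link Γ F)) ws) → Acyclic (Face (link Γ F))
    restore [] _ acyc = Acyclic-≐ (λ σ → proj₁ , λ y → y , []) acyc
    restore (w ∷ ws) ws⊆I acyc = restore ws (ws⊆I ∘ there)
      (add-Acyclic w (dels-down (link-down {Δ = Γ} Γ-down))
        (Acyclic-≐ (≐-sym (del-dels (Face (link Γ F)) w ws)) acyc)
        (link-vertex-Acyclic (ws⊆I (here refl)) (ws⊆I ∘ there)))

    crowded : Acyclic (Face (link Γ F))
    crowded = let w∉F , xw = link-vertex⁻ {Δ = Δ} down (proj₂ pI) in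
      restore (elements I) ∈-elements⁻
        (Acyclic-≐ (λ σ →
            (λ y → dels-elements⁺ {X = Face (link Γ F)}
              (avoiding-link x (proj₁ y) (dels-elements⁻ {X = Face (link Δ F)} y))
              (dels-elements⁻ {X = Face (link Δ F)} y)) ,
            (λ (y , a) → link-Γ⊆Δ y , a))
          (avoiding-Acyclic x (proj₁ pI) w∉F xw))

  dichotomy : ∀ F → Face Γ F → Dichotomy F
  dichotomy F x with any? (λ i → (i ∈? F) ×-dec (i ∈? I))
  ... | yes (i , i∈F , i∈I) = occupied x i∈F i∈I
  ... | no free
    with any? (λ p → any? λ q → IVertex? F p ×-dec (IVertex? F q ×-dec ¬? (p ≟ q)))
  ...   | yes (p , q , pI , qI , p≢q) =
    inj₂ (crowded x (λ v∈F v∈I → free (_ , v∈F , v∈I)) pI qI p≢q)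
  -- With `F` disjoint from `I` and at most one vertex of `I` in its link, no face of the link in
  -- `Δ` breaks the bound.
  ...   | no ¬pair = inj₁ λ σ → link-Γ⊆Δ , from
    where
    from : ∀ {σ} → Face (link Δ F) σ → Face (link Γ F) σ
    from {σ} y = let disj , z = link⁻ {Δ = Δ} y in
      link⁺ {Δ = Γ} disj (Γ⁺ z λ {u} {v} u∈ v∈ u∈I v∈I →
        decidable-stable (u ≟ v) λ u≢v →
          ¬pair (u , v , (u∈I , vertex u∈ u∈I) , (v∈I , vertex v∈ v∈I) , u≢v))
      where
      vertex : ∀ {u} → u ∈ σ ∪ F → u ∈ I → Face (link Δ F) ⁅ u ⁆
      vertex u∈ u∈I = [ (λ u∈σ → link-down {Δ = Δ} down (⁅⁆-⊆ u∈σ) y)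
                      , (λ u∈F → contradiction (_ , u∈F , u∈I) free) ]′ (x∈p∪q⁻ σ F u∈)

-- Spheres are not cones, and they are pure

module Apexes {c ℓ} (K : Field c ℓ) where
  open Field K hiding (zero; _-_) renaming (refl to ≈-refl; sym to ≈-sym; trans to ≈-trans)
  open Homology K
  open Operators K
  open Acyclicity K
  open Spheres K
  open Sphere

  private variable
    n d : ℕ
    X : Faces n

  -- The indicator of `∅` is a cycle of size 0, and without vertices nothing can bound it.
  ∅-not-Acyclic : X ∅ → (∀ {σ v} → v ∈ σ → ¬ X σ) → ¬ Acyclic X
  ∅-not-Acyclic {n} {X} x∅ only acyc = 0≉1 (≈-trans (≈-sym ∂b≈0) (≈-trans (∂b ∅) f∅))
    where
    f : Coeffs n
    f σ = if ∣ σ ∣ ≡ᵇ 0 then 1# else 0#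
    f∅ : f ∅ ≈ 1#
    f∅ rewrite ∣⊥∣≡0 n = ≈-refl
    f-supp : Supported X 0 f
    f-supp σ ¬x with nonempty? σ
    ... | no empty = contradiction
      (≡.subst X (≡.sym (Empty-unique empty)) x∅ ,
       ≡.trans (≡.cong ∣_∣ (Empty-unique empty)) (∣⊥∣≡0 n)) ¬x
    ... | yes (v , v∈σ) rewrite ≡.sym (∣delete∣ v∈σ) = ≈-refl
    f-cycle : Cycle f
    f-cycle τ = ∂-zero {τ = τ} {f = f} λ v v∉τ →
      reflexive (≡.cong (λ k → if k ≡ᵇ 0 then 1# else 0#) (∣insert∣ v∉τ))
    filled : Bounds X 0 f
    filled = acyc 0 f f-supp f-cycle
    ∂b = proj₂ (proj₂ filled)
    ∂b≈0 : ∂ (proj₁ filled) ∅ ≈ 0#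
    ∂b≈0 = ∂-zero {f = proj₁ filled} λ v _ →
      proj₁ (proj₂ filled) _ λ (x , _) → only ∈-insert x

  -- With an apex `c`, `delete-cone` could delete every vertex and keep acyclicity, yet only `∅`
  -- would remain.
  no-apex : ∀ {c} → DownClosed X → Flag X → (∀ σ → Dec (X σ)) → Sphere d X →
    X ⁅ c ⁆ → ¬ (∀ {w} → X ⁅ w ⁆ → w ≢ c → X (⁅ c ⁆ ∪ ⁅ w ⁆))
  no-apex {n} {X = X} {c = c} down flag X? S x adj = ∅-not-Acyclic
    ((down (λ v∈ → contradiction v∈ ∉⊥) x , ∉⊥) , All.tabulate λ _ → ∉⊥)
    (λ v∈σ (_ , avoid) → All.lookup avoid (∈-allFin _) v∈σ)
    (delete-cone (List.allFin n) down flag X? S x λ _ → adj)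

  -- Induction on `d`: removing `v` from a facet leaves a facet of the link of `v`, which is a
  -- sphere of dimension one less.
  facet-size : ∀ {σ} → DownClosed X → Sphere d X → X σ →
               (∀ v → v ∉ σ → ¬ X (σ ∪ ⁅ v ⁆)) → ∣ σ ∣ ≡ d
  facet-size {d = zero} down S x _ = ℕₚ.n≤0⇒n≡0 (size≤ S x)
  facet-size {X = X} {d = suc d} {σ} down S x maximal with nonempty? σ
  ... | no empty with ρ , y , eq ← topFace S with v , v∈ρ ← nonempty eq =
    contradiction
      (down (λ w∈ → [ (λ w∈σ → contradiction (_ , w∈σ) empty) , ⁅⁆-⊆ v∈ρ ]′
               (x∈p∪q⁻ σ ⁅ v ⁆ w∈)) y)
      (maximal v λ v∈σ → empty (v , v∈σ))
  ... | yes (v , v∈σ) with _ , refl , L ← links S (down (⁅⁆-⊆ v∈σ) x) =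
    ≡.trans (≡.sym (∣delete∣ v∈σ)) (≡.cong suc (facet-size (lk-down down) L
      (∉-delete σ v , ≡.subst X (≡.sym (insert-delete v∈σ)) x) maximal′))
    where
    maximal′ : ∀ w → w ∉ σ - v → ¬ lk X v ((σ - v) ∪ ⁅ w ⁆)
    maximal′ w w∉ (v∉ , y) = maximal w
      (λ w∈σ → w∉ (x∈p∧x≢y⇒x∈p-y w∈σ λ { refl → v∉ (∈-insert {σ = σ - v}) }))
      (≡.subst X (≡.trans (∪-swap (σ - v) ⁅ w ⁆ ⁅ v ⁆)
        (≡.cong (_∪ ⁅ w ⁆) (insert-delete v∈σ))) y)

-- Reflection of the Boolean connectives

allFin⁻ : ∀ {m} {f : Fin m → Bool} → allFin f ≡ true → ∀ i → f i ≡ true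
allFin⁻ eq zero    = proj₁ (∧⁻ eq)
allFin⁻ eq (suc i) = allFin⁻ (proj₂ (∧⁻ eq)) i

allFin⁺ : ∀ {m} {f : Fin m → Bool} → (∀ i → f i ≡ true) → allFin f ≡ true
allFin⁺ {zero}  f≡true = refl
allFin⁺ {suc m} f≡true = ∧⁺ (f≡true zero) (allFin⁺ (f≡true ∘ suc))

∨⁻ : ∀ {a b} → a ∨ b ≡ true → a ≡ true ⊎ b ≡ true
∨⁻ {true}  _  = inj₁ refl
∨⁻ {false} eq = inj₂ eq

∨⁺ : ∀ {a b} → a ≡ true ⊎ b ≡ true → a ∨ b ≡ true
∨⁺ {true}  _          = refl
∨⁺ {false} (inj₂ eq) = eq

⇒⁻ : ∀ {a b} → not a ∨ b ≡ true → a ≡ true → b ≡ true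
⇒⁻ {true} eq refl = eq

⇒⁺ : ∀ {a b} → (a ≡ true → b ≡ true) → not a ∨ b ≡ true
⇒⁺ {true}  f = f refl
⇒⁺ {false} f = refl

not⁻ : ∀ {a} → not a ≡ true → a ≢ true
not⁻ {false} _ ()

not⁺ : ∀ {a} → a ≢ true → not a ≡ true
not⁺ {true}  a≢ = contradiction refl a≢
not⁺ {false} _  = refl

anyFin⁻ : ∀ {m} {f : Fin m → Bool} → anyFin f ≡ true → ∃ λ i → f i ≡ true
anyFin⁻ {suc m} {f} eq with ∨⁻ {f zero} eq
... | inj₁ eq₀ = zero , eq₀
... | inj₂ eqₛ = let i , eqᵢ = anyFin⁻ eqₛ in suc i , eqᵢ

anyFin⁺ : ∀ {m} {f : Fin m → Bool} i → f i ≡ true → anyFin f ≡ true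
anyFin⁺ {suc m} {f} zero    eq = ∨⁺ {f zero} (inj₁ eq)
anyFin⁺ {suc m} {f} (suc i) eq = ∨⁺ {f zero} (inj₂ (anyFin⁺ i eq))

==⁻ : ∀ {m} {x y : Fin m} → (x == y) ≡ true → x ≡ y
==⁻ eq = toℕ-injective (ℕₚ.≡ᵇ⇒≡ _ _ (≡true⇒T eq))

==⁺ : ∀ {m} (x : Fin m) → (x == x) ≡ true
==⁺ x = T⇒≡true (ℕₚ.≡⇒≡ᵇ (toℕ x) _ refl)

-- Order complexes

module Chains (P : FinPoset) where
  open FinPoset P

  private variable
    F σ : Subset size
    u v w : Fin size

  Comparable : Fin size → Fin size → Set
  Comparable u v = le u v ≡ true ⊎ le v u ≡ true

  IsChain : Subset size → Set
  IsChain σ = (∀ {u} → u ∈ σ → u ∈ ground) ×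
              (∀ {u v} → u ∈ σ → v ∈ σ → Comparable u v)

  face⇔chain : Face (orderComplex P) ≐ IsChain
  face⇔chain σ = to , from
    where
    to : Face (orderComplex P) σ → IsChain σ
    to x = let gr , cmp = ∧⁻ x in
      (λ {u} u∈ → lookup⇒[]= u ground (⇒⁻ (allFin⁻ gr u) ([]=⇒lookup u∈))) ,
      (λ {u} {v} u∈ v∈ → ∨⁻ (⇒⁻ (allFin⁻ (allFin⁻ cmp u) v)
        (∧⁺ ([]=⇒lookup u∈) ([]=⇒lookup v∈))))
    from : IsChain σ → Face (orderComplex P) σ
    from (gr , cmp) = ∧⁺
      (allFin⁺ λ u → ⇒⁺ λ eq → []=⇒lookup (gr (lookup⇒[]= u σ eq)))
      (allFin⁺ λ u → allFin⁺ λ v → ⇒⁺ λ eq → let u∈ , v∈ = ∧⁻ eq in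
        ∨⁺ (cmp (lookup⇒[]= u σ u∈) (lookup⇒[]= v σ v∈)))

  chain⁻ : Face (orderComplex P) σ → IsChain σ
  chain⁻ = proj₁ (face⇔chain _)

  chain⁺ : IsChain σ → Face (orderComplex P) σ
  chain⁺ = proj₂ (face⇔chain _)

  chain-down : DownClosed (Face (orderComplex P))
  chain-down τ⊆σ x = let gr , cmp = chain⁻ x in
    chain⁺ (gr ∘ τ⊆σ , λ u∈ v∈ → cmp (τ⊆σ u∈) (τ⊆σ v∈))

  chain-flag : Flag (Face (orderComplex P))
  chain-flag σ u v x y z = chain⁺ (gr , cmp)
    where
    cases : ∀ {w} → w ∈ (σ ∪ ⁅ u ⁆) ∪ ⁅ v ⁆ → w ∈ σ ⊎ (w ≡ u ⊎ w ≡ v)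
    cases w∈ with x∈p∪q⁻ (σ ∪ ⁅ u ⁆) ⁅ v ⁆ w∈
    ... | inj₂ w∈v = inj₂ (inj₂ (x∈⁅y⁆⇒x≡y v w∈v))
    ... | inj₁ w∈σu with x∈p∪q⁻ σ ⁅ u ⁆ w∈σu
    ...   | inj₁ w∈σ = inj₁ w∈σ
    ...   | inj₂ w∈u = inj₂ (inj₁ (x∈⁅y⁆⇒x≡y u w∈u))
    cx : IsChain (σ ∪ ⁅ u ⁆)
    cx = chain⁻ x
    cy : IsChain (σ ∪ ⁅ v ⁆)
    cy = chain⁻ y
    cz : IsChain (⁅ u ⁆ ∪ ⁅ v ⁆)
    cz = chain⁻ z
    u∈ : ∀ {τ} → u ∈ τ ∪ ⁅ u ⁆
    u∈ {τ} = ∈-insert {σ = τ}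
    v∈ : ∀ {τ} → v ∈ τ ∪ ⁅ v ⁆
    v∈ {τ} = ∈-insert {σ = τ}
    u∈uv : u ∈ ⁅ u ⁆ ∪ ⁅ v ⁆
    u∈uv = p⊆p∪q ⁅ v ⁆ (x∈⁅x⁆ u)
    gr : ∀ {w} → w ∈ (σ ∪ ⁅ u ⁆) ∪ ⁅ v ⁆ → w ∈ ground
    gr w∈ with cases w∈
    ... | inj₁ w∈σ         = proj₁ cx (p⊆p∪q ⁅ u ⁆ w∈σ)
    ... | inj₂ (inj₁ refl) = proj₁ cx u∈
    ... | inj₂ (inj₂ refl) = proj₁ cy v∈
    cmp : ∀ {p q} → p ∈ (σ ∪ ⁅ u ⁆) ∪ ⁅ v ⁆ → q ∈ (σ ∪ ⁅ u ⁆) ∪ ⁅ v ⁆ → Comparable p q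
    cmp p∈ q∈ with cases p∈ | cases q∈
    ... | inj₁ p∈σ         | inj₁ q∈σ         = proj₂ cx (p⊆p∪q ⁅ u ⁆ p∈σ) (p⊆p∪q ⁅ u ⁆ q∈σ)
    ... | inj₁ p∈σ         | inj₂ (inj₁ refl) = proj₂ cx (p⊆p∪q ⁅ u ⁆ p∈σ) u∈
    ... | inj₁ p∈σ         | inj₂ (inj₂ refl) = proj₂ cy (p⊆p∪q ⁅ v ⁆ p∈σ) v∈
    ... | inj₂ (inj₁ refl) | inj₁ q∈σ         = proj₂ cx u∈ (p⊆p∪q ⁅ u ⁆ q∈σ)
    ... | inj₂ (inj₂ refl) | inj₁ q∈σ         = proj₂ cy v∈ (p⊆p∪q ⁅ v ⁆ q∈σ)
    ... | inj₂ (inj₁ refl) | inj₂ (inj₁ refl) = proj₂ cx u∈ u∈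
    ... | inj₂ (inj₂ refl) | inj₂ (inj₂ refl) = proj₂ cy v∈ v∈
    ... | inj₂ (inj₁ refl) | inj₂ (inj₂ refl) = proj₂ cz u∈uv v∈
    ... | inj₂ (inj₂ refl) | inj₂ (inj₁ refl) = proj₂ cz v∈ u∈uv

  insert⁻ : Face (orderComplex P) (F ∪ ⁅ w ⁆) →
            w ∈ ground × (∀ {f} → f ∈ F → Comparable f w)
  insert⁻ {F} {w} x = let gr , cmp = chain⁻ x in
    gr (∈-insert {σ = F}) , λ f∈F → cmp (p⊆p∪q ⁅ w ⁆ f∈F) (∈-insert {σ = F})

  insert⁺ : Face (orderComplex P) F → w ∈ ground → le w w ≡ true →
            (∀ {f} → f ∈ F → Comparable f w) → Face (orderComplex P) (F ∪ ⁅ w ⁆)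
  insert⁺ {F} {w} x w∈ w≤w w-cmp = chain⁺ (gr , cmp)
    where
    cF : IsChain F
    cF = chain⁻ x
    cases : ∀ {u} → u ∈ F ∪ ⁅ w ⁆ → u ∈ F ⊎ u ≡ w
    cases u∈ = Sum.map₂ (x∈⁅y⁆⇒x≡y w) (x∈p∪q⁻ F ⁅ w ⁆ u∈)
    gr : ∀ {u} → u ∈ F ∪ ⁅ w ⁆ → u ∈ ground
    gr u∈ with cases u∈
    ... | inj₁ u∈F  = proj₁ cF u∈F
    ... | inj₂ refl = w∈
    cmp : ∀ {u v} → u ∈ F ∪ ⁅ w ⁆ → v ∈ F ∪ ⁅ w ⁆ → Comparable u v
    cmp u∈ v∈ with cases u∈ | cases v∈
    ... | inj₁ u∈F  | inj₁ v∈F  = proj₂ cF u∈F v∈F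
    ... | inj₁ u∈F  | inj₂ refl = w-cmp u∈F
    ... | inj₂ refl | inj₁ v∈F  = Sum.swap (w-cmp v∈F)
    ... | inj₂ refl | inj₂ refl = inj₁ w≤w

-- Applied to a lattice order and to its dual.
module _ {n : ℕ} (_⊑_ : Fin n → Fin n → Bool)
  (⊑-trans : ∀ x y z → x ⊑ y ≡ true → y ⊑ z ≡ true → x ⊑ z ≡ true)
  (sup : ∀ x y → ∃ λ j → x ⊑ j ≡ true × y ⊑ j ≡ true ×
    (∀ w → x ⊑ w ≡ true → y ⊑ w ≡ true → j ⊑ w ≡ true))
  where

  private
    _≼_ : Fin n → Fin n → Set
    x ≼ y = x ⊑ y ≡ true

  supremum : ∀ {a} → a ≼ a → (xs : List (Fin n)) → ∃ λ j → a ≼ j × All (_≼ j) xs ×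
    (∀ w → a ≼ w → All (_≼ w) xs → j ≼ w)
  supremum {a} a≼a [] = a , a≼a , [] , λ w a≼w _ → a≼w
  supremum a≼a (x ∷ xs) =
    let j , a≼j , xs≼j , least = supremum a≼a xs
        k , x≼k , j≼k , least′ = sup x j
    in k , ⊑-trans _ _ _ a≼j j≼k ,
       x≼k ∷ All.map (λ y≼j → ⊑-trans _ _ _ y≼j j≼k) xs≼j ,
       λ { w a≼w (x≼w ∷ xs≼w) → least′ w x≼w (least w a≼w xs≼w) }

  -- j is the join of a and the elements of F below w outside [a,b].
  lowerApex : ∀ {a b w} {F : Subset n} → a ≼ a →
    (∀ {f g} → f ∈ F → g ∈ F → f ≼ g ⊎ g ≼ f) →
    a ≼ w → w ≼ b → (∀ {f} → f ∈ F → f ≼ w ⊎ w ≼ f) →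
    ∃ λ j → a ≼ j × j ≼ b × (∀ {f} → f ∈ F → f ≼ j ⊎ j ≼ f) ×
      (∀ {u} → a ≼ u → u ≼ b → (∀ {f} → f ∈ F → f ≼ u ⊎ u ≼ f) → j ≼ u)
  lowerApex {a} {b} {w} {F} a≼a chain a≼w w≼b w-cmp =
    j , a≼j , ⊑-trans _ _ _ j≼w w≼b , cmp , below-all
    where
    Outside : Fin n → Set
    Outside f = f ∈ F × f ≼ w × ¬ (a ≼ f × f ≼ b)
    outside? : ∀ f → Dec (Outside f)
    outside? f = (f ∈? F) ×-dec ((f ⊑ w ≟ᵇ true) ×-dec
      ¬? ((a ⊑ f ≟ᵇ true) ×-dec (f ⊑ b ≟ᵇ true)))
    join : ∃ λ j → a ≼ j × All (_≼ j) (filter outside? (List.allFin n)) ×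
      (∀ w → a ≼ w → All (_≼ w) (filter outside? (List.allFin n)) → j ≼ w)
    join = supremum a≼a (filter outside? (List.allFin n))
    j = proj₁ join
    a≼j = proj₁ (proj₂ join)
    below-all : ∀ {u} → a ≼ u → u ≼ b → (∀ {f} → f ∈ F → f ≼ u ⊎ u ≼ f) → j ≼ u
    below-all {u} a≼u u≼b u-cmp = proj₂ (proj₂ (proj₂ join)) u a≼u
      (All.tabulate λ {f} f∈ →
        let f∈F , f≼w , ¬inside = proj₂ (∈-filter⁻ outside? {xs = List.allFin n} f∈) in
        -- If `u` were below `f`, then `f` would lie between `a` and `b`, contrary to the choice of
        -- `f`.
        [ id , (λ u≼f → contradiction
          (⊑-trans _ _ _ a≼u u≼f , ⊑-trans _ _ _ f≼w w≼b) ¬inside) ]′ (u-cmp f∈F))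
    j≼w : j ≼ w
    j≼w = below-all a≼w w≼b w-cmp
    cmp : ∀ {f} → f ∈ F → f ≼ j ⊎ j ≼ f
    cmp {f} f∈F with (a ⊑ f ≟ᵇ true) ×-dec (f ⊑ b ≟ᵇ true) | w-cmp f∈F
    -- An element of the chain `F` inside the interval is comparable with all of `F`, so it is
    -- itself one of the elements above `j`.
    ... | yes (a≼f , f≼b) | _ = inj₂ (below-all a≼f f≼b λ g∈F → chain g∈F f∈F)
    ... | no ¬inside | inj₁ f≼w = inj₁ (All.lookup (proj₁ (proj₂ (proj₂ join)))
      (∈-filter⁺ outside? (∈-allFin f) (f∈F , f≼w , ¬inside)))
    ... | no _ | inj₂ w≼f = inj₂ (⊑-trans _ _ _ j≼w w≼f)

-- The order of P ⊖ [a,b]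

Relation : FinPoset → Set
Relation P = Fin (FinPoset.size P) → Fin (FinPoset.size P) → Bool

data SameRelation (P : FinPoset) (r : Relation P) : Relation P → Set where
  same : SameRelation P r r

record Endpoints (P : FinPoset) : Set where
  field lo hi : Fin (FinPoset.size P)
open Endpoints

-- The iteration defining the order of P ⊖ [a,b] is local to ⊖ and cannot be
-- named. The body of reach is found by unification: abstracting the iteration
-- count in reach-le leaves exactly one solution.
reach : (P : FinPoset) → Endpoints P → ℕ → Relation P

reach-le : ∀ P I → SameRelation P (FinPoset.le (⊖ P (lo I) (hi I)))
                              (reach P I (FinPoset.size P))

reach = _

reach-le P I with FinPoset.size P
... | _ = same

module Removal (P : FinPoset) (I : Endpoints P) where
  open FinPoset P

  inI : Fin size → Bool
  inI x = lookup (ground) x ∧ le (lo I) x ∧ le x (hi I)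

  step : Fin size → Fin size → Bool
  step x y = covers P x y ∧ not (inI x ∧ inI y)

  data Path (x : Fin size) : Fin size → Set where
    []  : Path x x
    _∷_ : ∀ {y z} → Path x z → step z y ≡ true → Path x y

  _++_ : ∀ {x y z} → Path x y → Path y z → Path x z
  p ++ []      = p
  p ++ (q ∷ e) = (p ++ q) ∷ e

  reach⇒Path : ∀ k {x y} → reach P I k x y ≡ true → Path x y
  reach⇒Path zero {x} {y} eq with refl ← ==⁻ {x = x} {y} eq = []
  reach⇒Path (suc k) {x} {y} eq with ∨⁻ {reach P I k x y} eq
  ... | inj₁ eq′ = reach⇒Path k eq′
  ... | inj₂ any with z , both ← anyFin⁻ any
      with r , e ← ∧⁻ {reach P I k x z} both = reach⇒Path k r ∷ e

  reach-mono : ∀ {k l x y} → k ≤ l → reach P I k x y ≡ true → reach P I l x y ≡ true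
  reach-mono {k} {l} {x} {y} k≤l eq = go (ℕₚ.≤⇒≤′ k≤l)
    where
    go : ∀ {l} → k ℕ.≤′ l → reach P I l x y ≡ true
    go (ℕ.≤′-reflexive refl) = eq
    go {suc l} (ℕ.≤′-step k≤l) = ∨⁺ {reach P I l x y} (inj₁ (go k≤l))

  -- A path to `y` has at most `height y` steps, for any function that increases along steps; so
  -- that many rounds of the iteration suffice.
  Path⇒reach : (height : Fin size → ℕ) →
    (∀ {z y} → step z y ≡ true → height z < height y) →
    ∀ {x y} → Path x y → reach P I (height y) x y ≡ true
  Path⇒reach height climb {x} [] = reach-mono {zero} {height x} {x} {x} z≤n (==⁺ x)
  Path⇒reach height climb {x} (_∷_ {y} {z} p e) = reach-mono {x = x} {y} (climb e)
    (∨⁺ {reach P I (height z) x y} (inj₂ (anyFin⁺ z (∧⁺ (Path⇒reach height climb p) e))))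

  le⇒Path : ∀ {x y} → FinPoset.le (⊖ P (lo I) (hi I)) x y ≡ true → Path x y
  le⇒Path = reach⇒Path size

-- Removing an interval from the proper part of a lattice

module LatticeRemoval {c ℓ} (K : Field c ℓ) (L : FinLattice)
  (G : Main.GorensteinLattice K L) where
  open FinLattice L renaming (refl to le-refl; trans to le-trans; antisym to le-antisym)
  open Main K using (CMPoset)
  open Acyclicity K
  open Spheres K
  open GorensteinLinks K
  open Apexes K

  P : FinPoset
  P = properPart

  open FinPoset P using (ground)
  open Chains P

  Δ : Complex size
  Δ = orderComplex P

  private variable
    x y z t u v w : Fin size

  infix 4 _⊑_ _⊏_
  _⊑_ _⊏_ : Fin size → Fin size → Set
  x ⊑ y = le x y ≡ true
  x ⊏ y = x ⊑ y × x ≢ y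

  ⊑-trans : x ⊑ y → y ⊑ z → x ⊑ z
  ⊑-trans = le-trans _ _ _

  ⊑-antisym : x ⊑ y → y ⊑ x → x ≡ y
  ⊑-antisym = le-antisym _ _

  ⊑-⊏-trans : x ⊑ y → y ⊏ z → x ⊏ z
  ⊑-⊏-trans x⊑y (y⊑z , y≢z) =
    ⊑-trans x⊑y y⊑z , λ { refl → y≢z (⊑-antisym y⊑z x⊑y) }

  ⊏-⊑-trans : x ⊏ y → y ⊑ z → x ⊏ z
  ⊏-⊑-trans (x⊑y , x≢y) y⊑z =
    ⊑-trans x⊑y y⊑z , λ { refl → x≢y (⊑-antisym x⊑y y⊑z) }

  ground-convex : x ∈ ground → z ∈ ground → x ⊑ y → y ⊑ z → y ∈ ground
  ground-convex {x} {z} {y} x∈ z∈ x⊑y y⊑z = ∈-tabulate⁺ (∧⁺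
    (not⁺ λ eq → not⁻ (proj₁ (∧⁻ (∈-tabulate⁻ x∈)))
      (≡.subst (λ p → (p == bot) ≡ true)
        (⊑-antisym (bot-min x) (≡.subst (x ⊑_) (==⁻ {x = y} {bot} eq) x⊑y)) (==⁺ bot)))
    (not⁺ λ eq → not⁻ (proj₂ (∧⁻ {not (z == bot)} (∈-tabulate⁻ z∈)))
      (≡.subst (λ p → (p == top) ≡ true)
        (⊑-antisym (≡.subst (_⊑ z) (==⁻ {x = y} {top} eq) y⊑z) (top-max z)) (==⁺ top))))

  edge⁺ : u ∈ ground → v ∈ ground → Comparable u v → Face Δ (⁅ u ⁆ ∪ ⁅ v ⁆)
  edge⁺ {u} {v} u∈ v∈ cmp = insert⁺
    (chain⁺ ( (λ w∈ → ≡.subst (_∈ ground) (≡.sym (x∈⁅y⁆⇒x≡y u w∈)) u∈)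
            , λ p∈ q∈ → inj₁ (≡.subst₂ _⊑_ (≡.sym (x∈⁅y⁆⇒x≡y u p∈))
                                           (≡.sym (x∈⁅y⁆⇒x≡y u q∈)) (le-refl u))))
    v∈ (le-refl v) λ w∈ → ≡.subst (λ w → Comparable w v) (≡.sym (x∈⁅y⁆⇒x≡y u w∈)) cmp

  Between : Fin size → Fin size → Fin size → Set
  Between x y t = t ∈ ground × x ⊏ t × t ⊏ y

  -- Otherwise c would be an apex of the link of {x,y}.
  no-center : x ∈ ground → y ∈ ground → x ⊏ w → w ⊏ y →
              ¬ (∀ {t} → Between x y t → Comparable w t)
  no-center {x} {y} {c} x∈ y∈ (x⊑c , x≢c) (c⊑y , c≢y) cmp = no-apex {c = c}
    (link-down {Δ = Δ} chain-down {F = F})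
    (link-flag {Δ = Δ} chain-down chain-flag {F = F})
    (λ σ → link Δ F σ ≟ᵇ true) (proj₂ (link-sphere chain-down G xy))
    (link-vertex⁺ {Δ = Δ} chain-down c∉F xyc)
    λ {w} z _ → adjacent {w} (link-vertex⁻ {Δ = Δ} chain-down z)
    where
    F : Subset size
    F = ⁅ x ⁆ ∪ ⁅ y ⁆
    c∈ : c ∈ ground
    c∈ = ground-convex x∈ y∈ x⊑c c⊑y
    xy : Face Δ F
    xy = edge⁺ x∈ y∈ (inj₁ (⊑-trans x⊑c c⊑y))
    xyc : Face Δ (F ∪ ⁅ c ⁆)
    xyc = chain-flag ⁅ x ⁆ y c xy (edge⁺ x∈ c∈ (inj₁ x⊑c)) (edge⁺ y∈ c∈ (inj₂ c⊑y))
    c∉F : c ∉ F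
    c∉F = ∉-insert (x≢c ∘ ≡.sym ∘ x∈⁅y⁆⇒x≡y x) c≢y
    adjacent : ∀ {w} → w ∉ F × Face Δ (F ∪ ⁅ w ⁆) → Face (link Δ F) (⁅ c ⁆ ∪ ⁅ w ⁆)
    adjacent {w} (w∉F , xw) with w∈ , w-cmp ← insert⁻ xw =
      link-edge {Δ = Δ} chain-down chain-flag c∉F w∉F xyc xw (edge⁺ c∈ w∈
        -- Vertices of the link below `x` or above `y` are comparable with `c` by transitivity; only
        -- those strictly between use `cmp`.
        (case w-cmp x∈F of λ
          { (inj₂ w⊑x) → inj₂ (⊑-trans w⊑x x⊑c)
          ; (inj₁ x⊑w) → case w-cmp y∈F of λ
            { (inj₁ y⊑w) → inj₁ (⊑-trans c⊑y y⊑w)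
            ; (inj₂ w⊑y) → cmp (w∈ , (x⊑w , λ { refl → w∉F x∈F }) , (w⊑y , λ { refl → w∉F y∈F }))
            } }))
      where
      x∈F : x ∈ F
      x∈F = p⊆p∪q ⁅ y ⁆ (x∈⁅x⁆ x)
      y∈F : y ∈ F
      y∈F = ∈-insert {σ = ⁅ x ⁆}

  interval : Fin size → Fin size → Subset size
  interval x y = tabulate λ t → le x t ∧ le t y

  ∈-interval⁺ : x ⊑ t → t ⊑ y → t ∈ interval x y
  ∈-interval⁺ x⊑t t⊑y = ∈-tabulate⁺ (∧⁺ x⊑t t⊑y)

  ∈-interval⁻ : t ∈ interval x y → x ⊑ t × t ⊑ y
  ∈-interval⁻ t∈ = ∧⁻ (∈-tabulate⁻ t∈)

  width : Fin size → Fin size → ℕ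
  width x y = ∣ interval x y ∣

  width-<ˡ : x ⊑ t → t ⊏ y → width x t < width x y
  width-<ˡ {x} {t} {y} x⊑t (t⊑y , t≢y) = p⊂q⇒∣p∣<∣q∣
    ( (λ s∈ → let x⊑s , s⊑t = ∈-interval⁻ s∈ in ∈-interval⁺ x⊑s (⊑-trans s⊑t t⊑y))
    , y , ∈-interval⁺ (⊑-trans x⊑t t⊑y) (le-refl y)
    , λ y∈ → t≢y (⊑-antisym t⊑y (proj₂ (∈-interval⁻ {x = x} y∈))))

  width-<ʳ : x ⊏ t → t ⊑ y → width t y < width x y
  width-<ʳ {x} {t} {y} (x⊑t , x≢t) t⊑y = p⊂q⇒∣p∣<∣q∣
    ( (λ s∈ → let t⊑s , s⊑y = ∈-interval⁻ s∈ in ∈-interval⁺ (⊑-trans x⊑t t⊑s) s⊑y)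
    , x , ∈-interval⁺ (le-refl x) (⊑-trans x⊑t t⊑y)
    , λ x∈ → x≢t (⊑-antisym x⊑t (proj₁ (∈-interval⁻ {y = y} x∈))))

  between? : ∀ x y t → Dec (Between x y t)
  between? x y t = (t ∈? ground) ×-dec
    (((le x t ≟ᵇ true) ×-dec ¬? (x ≟ t)) ×-dec ((le t y ≟ᵇ true) ×-dec ¬? (t ≟ y)))

  covers⁻ : covers P x y ≡ true → x ∈ ground × y ∈ ground × x ⊏ y
  covers⁻ {x} {y} eq
    with x∈ , eq₁ ← ∧⁻ eq
    with y∈ , eq₂ ← ∧⁻ eq₁
    with x≢y , eq₃ ← ∧⁻ {not (x == y)} eq₂
    with x⊑y , _ ← ∧⁻ {le x y} eq₃ =
    lookup⇒[]= x ground x∈ , lookup⇒[]= y ground y∈ ,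
    x⊑y , λ { refl → not⁻ x≢y (==⁺ x) }

  covers⁺ : x ∈ ground → y ∈ ground → x ⊏ y → (∀ t → ¬ Between x y t) →
            covers P x y ≡ true
  covers⁺ {x} {y} x∈ y∈ (x⊑y , x≢y) none =
    ∧⁺ ([]=⇒lookup x∈) (∧⁺ ([]=⇒lookup y∈) (∧⁺ (not⁺ (x≢y ∘ ==⁻)) (∧⁺ x⊑y
      (not⁺ λ any → let t , eq = anyFin⁻ any in none t (between t eq)))))
    where
    between : ∀ t → (lookup ground t ∧ not (t == x) ∧ not (t == y) ∧ le x t ∧ le t y) ≡ true →
              Between x y t
    between t eq
      with t∈ , eq₁ ← ∧⁻ {lookup ground t} eq
      with t≢x , eq₂ ← ∧⁻ {not (t == x)} eq₁
      with t≢y , eq₃ ← ∧⁻ {not (t == y)} eq₂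
      with x⊑t , t⊑y ← ∧⁻ {le x t} eq₃ =
      lookup⇒[]= t ground t∈ ,
      (x⊑t , λ { refl → not⁻ t≢x (==⁺ t) }) ,
      (t⊑y , λ { refl → not⁻ t≢y (==⁺ t) })

  module _ (a b : Fin size) (a∈ : a ∈ ground) (b∈ : b ∈ ground) where

    I : Endpoints P
    I = record { lo = a ; hi = b }

    open Removal P I

    le⊖ : Fin size → Fin size → Bool
    le⊖ = FinPoset.le (⊖ P a b)

    In : Fin size → Set
    In x = x ∈ ground × a ⊑ x × x ⊑ b

    inI⁻ : inI x ≡ true → In x
    inI⁻ {x} eq =
      let x∈ , eq′ = ∧⁻ {lookup ground x} eq in lookup⇒[]= x ground x∈ , ∧⁻ eq′

    inI⁺ : In x → inI x ≡ true
    inI⁺ (x∈ , a⊑x , x⊑b) = ∧⁺ ([]=⇒lookup x∈) (∧⁺ a⊑x x⊑b)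

    in? : ∀ x → Dec (In x)
    in? x = (x ∈? ground) ×-dec ((le a x ≟ᵇ true) ×-dec (le x b ≟ᵇ true))

    In-convex : In x → In z → x ⊑ y → y ⊑ z → In y
    In-convex (x∈ , a⊑x , _) (z∈ , _ , z⊑b) x⊑y y⊑z =
      ground-convex x∈ z∈ x⊑y y⊑z , ⊑-trans a⊑x x⊑y , ⊑-trans y⊑z z⊑b

    step⁻ : step x y ≡ true → x ∈ ground × y ∈ ground × x ⊏ y × ¬ (In x × In y)
    step⁻ {x} {y} eq =
      let cov , out = ∧⁻ {covers P x y} eq
          x∈ , y∈ , x⊏y = covers⁻ cov
      in x∈ , y∈ , x⊏y , λ (ix , iy) → not⁻ out (∧⁺ (inI⁺ ix) (inI⁺ iy))

    -- Intervals are convex, so a path with both ends in the interval would have its last step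
    -- inside, and such steps were removed.
    Path⇒⊏ : Path x y → x ≡ y ⊎ (x ⊏ y × ¬ (In x × In y))
    Path⇒⊏ [] = inj₁ refl
    Path⇒⊏ {x} {y} (p ∷ e) with Path⇒⊏ p | step⁻ e
    ... | inj₁ refl | _ , _ , x⊏y , out = inj₂ (x⊏y , out)
    ... | inj₂ (x⊏z , _) | _ , _ , z⊏y , out = inj₂
      ( ⊏-⊑-trans x⊏z (proj₁ z⊏y)
      , λ (ix , iy) → out (In-convex ix iy (proj₁ x⊏z) (proj₁ z⊏y) , iy))

    -- The interval (x,y) cannot lie above x ∨ a, nor below y ∧ b.
    split : x ∈ ground → y ∈ ground → ¬ (In x × In y) → ∃ (Between x y) →
      ∃ λ t → Between x y t × ¬ (In x × In t) × ¬ (In t × In y)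
    split {x} {y} x∈ y∈ out (s , s∈ , x⊏s , s⊏y)
      with any? (λ t → between? x y t ×-dec
             (¬? (in? x ×-dec in? t) ×-dec ¬? (in? t ×-dec in? y)))
    ... | yes found = found
    ... | no none with in? x | in? y
    ...   | yes ix | yes iy = contradiction (ix , iy) out
    ...   | no ¬ix | no ¬iy =
      s , (s∈ , x⊏s , s⊏y) , ¬ix ∘ proj₁ , ¬iy ∘ proj₂
    -- Every `t` strictly between lies in the interval, for otherwise it would split the pair. So
    -- `x ∨ a` is below all of them, and it differs from `x` because `x` is outside the interval.
    ...   | no ¬ix | yes (_ , _ , y⊑b) = ⊥-elim (no-center {w = m} x∈ y∈
      (x⊑m , λ x≡m → ¬ix (x∈ , ≡.subst (a ⊑_) (≡.sym x≡m) a⊑m ,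
                          ⊑-trans (proj₁ x⊏s) (⊑-trans (proj₁ s⊏y) y⊑b)))
      (⊑-⊏-trans (m⊑ (s∈ , x⊏s , s⊏y)) s⊏y)
      (inj₁ ∘ m⊑))
      where
      m = proj₁ (join x a)
      x⊑m = proj₁ (proj₂ (join x a))
      a⊑m = proj₁ (proj₂ (proj₂ (join x a)))
      m⊑ : Between x y t → m ⊑ t
      m⊑ {t} bt@(_ , x⊏t , _) = proj₂ (proj₂ (proj₂ (join x a))) t (proj₁ x⊏t)
        (proj₁ (proj₂ (decidable-stable (in? t) λ ¬it →
          none (t , bt , ¬ix ∘ proj₁ , ¬it ∘ proj₁))))
    -- The dual case, with `y ∧ b` above everything strictly between.
    ...   | yes (_ , a⊑x , _) | no ¬iy = ⊥-elim (no-center {w = m} x∈ y∈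
      (⊏-⊑-trans x⊏s (⊑m (s∈ , x⊏s , s⊏y)))
      (m⊑y , λ m≡y → ¬iy (y∈ , ⊑-trans a⊑x (⊑-trans (proj₁ x⊏s) (proj₁ s⊏y)) ,
                          ≡.subst (_⊑ b) m≡y m⊑b))
      (inj₂ ∘ ⊑m))
      where
      m = proj₁ (meet y b)
      m⊑y = proj₁ (proj₂ (meet y b))
      m⊑b = proj₁ (proj₂ (proj₂ (meet y b)))
      ⊑m : Between x y t → t ⊑ m
      ⊑m {t} bt@(_ , _ , t⊏y) = proj₂ (proj₂ (proj₂ (meet y b))) t (proj₁ t⊏y)
        (proj₂ (proj₂ (decidable-stable (in? t) λ ¬it →
          none (t , bt , ¬it ∘ proj₂ , ¬iy ∘ proj₂))))

    -- Induction on the number of elements of the closed interval from `x` to `y`: `split` cuts the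
    -- pair into two smaller ones, neither inside the removed interval, until only surviving covers
    -- remain.
    ⊏⇒Path : x ∈ ground → y ∈ ground → x ⊏ y → ¬ (In x × In y) → Path x y
    ⊏⇒Path {x} {y} = <-rec (λ k → ∀ x y → width x y ≡ k → x ∈ ground → y ∈ ground →
      x ⊏ y → ¬ (In x × In y) → Path x y) connect (width x y) x y refl
      where
      connect : ∀ k → (∀ {l} → l < k → ∀ x y → width x y ≡ l → x ∈ ground → y ∈ ground →
          x ⊏ y → ¬ (In x × In y) → Path x y) →
        ∀ x y → width x y ≡ k → x ∈ ground → y ∈ ground →
        x ⊏ y → ¬ (In x × In y) → Path x y
      connect k rec x y refl x∈ y∈ x⊏y out with any? (between? x y)
      ... | no none = [] ∷ ∧⁺ (covers⁺ x∈ y∈ x⊏y λ t bt → none (t , bt))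
        (not⁺ λ eq → let ix , iy = ∧⁻ eq in out (inI⁻ ix , inI⁻ iy))
      ... | yes some with t , (t∈ , x⊏t , t⊏y) , out₁ , out₂ ← split x∈ y∈ out some =
        rec (width-<ˡ (proj₁ x⊏t) t⊏y) x t refl x∈ t∈ x⊏t out₁ ++
        rec (width-<ʳ x⊏t (proj₁ t⊏y)) t y refl t∈ y∈ t⊏y out₂

    step-climbs : step x y ≡ true → width bot x < width bot y
    step-climbs eq = let _ , _ , x⊏y , _ = step⁻ eq in width-<ˡ (bot-min _) x⊏y

    Path⇒le : Path x y → le⊖ x y ≡ true
    -- The number of elements below `y` serves as height; it is at most `size`, the number of rounds
    -- in the definition of `⊖`.
    Path⇒le {x} {y} p = reach-mono {width bot y} {size} {x} {y} (∣p∣≤n (interval bot y))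
      (Path⇒reach (width bot) step-climbs p)

    members : Subset size
    members = tabulate inI

    Γ : Complex size
    Γ = orderComplex (⊖ P a b)

    module Γ-Chains = Chains (⊖ P a b)

    sparse : Face Γ ≐ λ σ → Face Δ σ × AtMostOne members σ
    sparse σ = to , from
      where
      to : Face Γ σ → Face Δ σ × AtMostOne members σ
      to x = chain⁺ (proj₁ ch , λ u∈ v∈ → Sum.map weaken weaken (proj₂ ch u∈ v∈)) , amo
        where
        ch = Γ-Chains.chain⁻ x
        weaken : ∀ {u v} → le⊖ u v ≡ true → u ⊑ v
        weaken eq with Path⇒⊏ (le⇒Path eq)
        ... | inj₁ refl          = le-refl _
        ... | inj₂ ((u⊑v , _) , _) = u⊑v
        distinct : ∀ {u v} → In u → In v → le⊖ u v ≡ true → u ≡ v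
        distinct iu iv eq with Path⇒⊏ (le⇒Path eq)
        ... | inj₁ u≡v       = u≡v
        ... | inj₂ (_ , out) = contradiction (iu , iv) out
        amo : AtMostOne members σ
        amo u∈ v∈ u∈I v∈I =
          let iu = inI⁻ (∈-tabulate⁻ u∈I) ; iv = inI⁻ (∈-tabulate⁻ v∈I) in
          [ distinct iu iv , ≡.sym ∘ distinct iv iu ]′ (proj₂ ch u∈ v∈)
      from : Face Δ σ × AtMostOne members σ → Face Γ σ
      from (x , amo) = Γ-Chains.chain⁺ (proj₁ ch , cmp)
        where
        ch = chain⁻ x
        cmp : ∀ {u v} → u ∈ σ → v ∈ σ → Γ-Chains.Comparable u v
        cmp {u} {v} u∈ v∈ with u ≟ v
        ... | yes refl = inj₁ (Path⇒le [])
        ... | no u≢v = Sum.map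
          (λ u⊑v → Path⇒le (⊏⇒Path (proj₁ ch u∈) (proj₁ ch v∈) (u⊑v , u≢v) out))
          (λ v⊑u → Path⇒le (⊏⇒Path (proj₁ ch v∈) (proj₁ ch u∈) (v⊑u , u≢v ∘ ≡.sym)
            λ (iv , iu) → out (iu , iv)))
          (proj₂ ch u∈ v∈)
          where
          out : ¬ (In u × In v)
          out (iu , iv) = u≢v (amo u∈ v∈ (∈-tabulate⁺ (inI⁺ iu)) (∈-tabulate⁺ (inI⁺ iv)))

    -- The least and the greatest element of the interval comparable with all of `F` are each
    -- comparable with every candidate `u`. At least one of them is outside `F`, and that one is the
    -- apex.
    apex : ∀ {F w} → Face Γ F → w ∈ members → w ∉ F → Face Δ (F ∪ ⁅ w ⁆) →
      ∃ λ c → c ∈ members × c ∉ F × Face Δ (F ∪ ⁅ c ⁆) ×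
        (∀ {u} → u ∈ members → u ∉ F → Face Δ (F ∪ ⁅ u ⁆) → Face Δ (⁅ c ⁆ ∪ ⁅ u ⁆))
    apex {F} {w} x w∈I w∉F xw
      with xF , amo ← proj₁ (sparse F) x
      with w∈ , w-cmp ← insert⁻ {F} {w} xw
      with _ , a⊑w , w⊑b ← inI⁻ (∈-tabulate⁻ {f = inI} w∈I)
      with p , a⊑p , p⊑b , p-cmp , p⊑ ← lowerApex le le-trans join {a} {b} {w} {F} (le-refl a)
             (proj₂ (chain⁻ xF)) a⊑w w⊑b w-cmp
      -- The same construction in the dual lattice, with `a` and `b` exchanged.
      with q , q⊑b , a⊑q , q-cmp , ⊑q ← lowerApex (flip le) (λ x y z p q → le-trans z y x q p)
             meet {b} {a} {w} {F} (le-refl b)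
             (λ f∈ g∈ → Sum.swap (proj₂ (chain⁻ xF) f∈ g∈)) w⊑b a⊑w (Sum.swap ∘ w-cmp) =
      choose (p ∈? F)
      where
      Apex : Set
      Apex = ∃ λ c → c ∈ members × c ∉ F × Face Δ (F ∪ ⁅ c ⁆) ×
        (∀ {u} → u ∈ members → u ∉ F → Face Δ (F ∪ ⁅ u ⁆) → Face Δ (⁅ c ⁆ ∪ ⁅ u ⁆))
      member : ∀ {c} → a ⊑ c → c ⊑ b → In c
      member a⊑c c⊑b = ground-convex a∈ b∈ a⊑c c⊑b , a⊑c , c⊑b
      build : ∀ {c} → In c → c ∉ F → (∀ {f} → f ∈ F → Comparable f c) →
        (∀ {u} → In u → (∀ {f} → f ∈ F → Comparable f u) → Comparable c u) → Apex
      build {c} ic@(c∈ , _) c∉F c-cmp central =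
        c , ∈-tabulate⁺ (inI⁺ ic) , c∉F , insert⁺ xF c∈ (le-refl c) c-cmp ,
        λ u∈I _ xu → let u∈ , u-cmp = insert⁻ {F} xu in
          edge⁺ c∈ u∈ (central (inI⁻ (∈-tabulate⁻ {f = inI} u∈I)) u-cmp)
      choose : Dec (p ∈ F) → Apex
      choose (no p∉F) = build (member a⊑p p⊑b) p∉F p-cmp
        λ (_ , a⊑u , u⊑b) u-cmp → inj₁ (p⊑ a⊑u u⊑b u-cmp)
      choose (yes p∈F) = build (member a⊑q q⊑b) q∉F (Sum.swap ∘ q-cmp)
        λ (_ , a⊑u , u⊑b) u-cmp → inj₂ (⊑q u⊑b a⊑u (Sum.swap ∘ u-cmp))
        where
        -- If q were also in F, then p = q, so p ≤ w ≤ q would give w ∈ F.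
        q∉F : q ∉ F
        q∉F q∈F with amo p∈F q∈F (∈-tabulate⁺ (inI⁺ (member a⊑p p⊑b)))
                                 (∈-tabulate⁺ (inI⁺ (member a⊑q q⊑b)))
        ... | refl = w∉F (≡.subst (_∈ F) (⊑-antisym (p⊑ a⊑w w⊑b w-cmp)
          (⊑q w⊑b a⊑w (Sum.swap ∘ w-cmp))) p∈F)

    open Sparse K chain-down chain-flag G members sparse apex

    removal-CM : CMPoset (⊖ P a b)
    removal-CM F x d ((σ , xσ , eq) , bound) s s<d with dichotomy F x
    ... | inj₂ acyc = fromVanishes (acyc s)
    ... | inj₁ e = fromVanishes (Vanishes-≐ (≐-sym e) (toVanishes
      (proj₁ G F (Γ⇒Δ {F} x) d
        ((σ , proj₁ (e σ) xσ , eq) , λ τ y → bound τ (proj₂ (e τ) y)) s s<d)))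

    -- The link in `Γ` of a maximal chain is the complex with only face `∅`, which is not acyclic;
    -- by the dichotomy it is then also the link in `Δ`.
    removal-maximal : ∀ {σ} → Face Γ σ → (∀ v → v ∉ σ → ¬ Face Γ (σ ∪ ⁅ v ⁆)) →
                      ∀ v → v ∉ σ → ¬ Face Δ (σ ∪ ⁅ v ⁆)
    removal-maximal {σ} x maximal v v∉σ y with dichotomy σ x
    ... | inj₁ e = maximal v v∉σ (proj₂ (link-vertex⁻ {Δ = Γ} Γ-down {F = σ}
      (proj₂ (e ⁅ v ⁆) (link-vertex⁺ {Δ = Δ} chain-down {F = σ} v∉σ y))))
    ... | inj₂ acyc = ∅-not-Acyclic (link-∅ {Δ = Γ} Γ-down {F = σ} x)
      (λ {τ} {w} w∈τ z → let w∉σ , xw = link-vertex⁻ {Δ = Γ} Γ-down {F = σ}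
                               (link-down {Δ = Γ} Γ-down {F = σ} (⁅⁆-⊆ w∈τ) z)
                         in maximal w w∉σ xw)
      acyc

  -- Gradedness and equality of ranks

  sphere : ∃ λ d → Sphere d (Face Δ)
  sphere = let d , S = link-sphere chain-down G ∅-chain in
    d , Sphere-≐ (λ σ → to σ , from σ) S
    where
    ∅-chain : Face Δ ∅
    ∅-chain = chain⁺ ((λ v∈ → contradiction v∈ ∉⊥) , λ v∈ → contradiction v∈ ∉⊥)
    to : ∀ σ → Face (link Δ ∅) σ → Face Δ σ
    to σ x = ≡.subst (Face Δ) (∪-identityʳ σ) (proj₂ (link⁻ {σ = σ} {Δ = Δ} x))
    from : ∀ σ → Face Δ σ → Face (link Δ ∅) σ
    from σ x = link⁺ {σ = σ} {F = ∅} {Δ = Δ} (λ _ → ∉⊥) (≡.subst (Face Δ) (≡.sym (∪-identityʳ σ)) x)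

  not-extendable : ∀ {Q : Subset size → Bool} {σ} →
    (∀ {τ} → Q τ ≡ true → τ ⊆ ground) →
    (∀ v → lookup ground v ≡ true → lookup σ v ≡ false → Q (σ ∪ ⁅ v ⁆) ≡ false) →
    ∀ v → v ∉ σ → ¬ (Q (σ ∪ ⁅ v ⁆) ≡ true)
  not-extendable {σ = σ} ⊆ground maximal v v∉σ x =
    case ≡.trans (≡.sym x) (maximal v ([]=⇒lookup (⊆ground x (∈-insert {σ = σ})))
                                      (∉⇒lookup v∉σ)) of λ ()

  graded : GradedChainSize P (proj₁ sphere)
  graded σ x maximal = facet-size {σ = σ} chain-down (proj₂ sphere) x
    (not-extendable {Q = Δ} {σ} (λ {τ} y → proj₁ (chain⁻ {σ = τ} y)) maximal)

  -- Maximal chains after the removal are facets of the original sphere, so purity gives them the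
  -- same size as before.
  removal-graded : ∀ a b → a ∈ ground → b ∈ ground → GradedChainSize (⊖ P a b) (proj₁ sphere)
  removal-graded a b a∈ b∈ σ x maximal = facet-size {σ = σ} chain-down (proj₂ sphere)
    (proj₁ (proj₁ (sparse a b a∈ b∈ σ) x))
    (removal-maximal a b a∈ b∈ {σ} x (not-extendable {Q = orderComplex (⊖ P a b)} {σ}
      (λ {τ} y → proj₁ (Chains.chain⁻ (⊖ P a b) {τ} y)) maximal))

theorem1p1 : ∀ {c ℓ : Level} (K : Field c ℓ) (L : FinLattice) →
    Main.GorensteinLattice K L →
    Main.EdgewiseStronglyCM K (FinLattice.properPart L)
theorem1p1 K L G = proj₁ G , λ a b a∈ b∈ _ →
  let a∈′ = lookup⇒[]= a _ a∈ ; b∈′ = lookup⇒[]= b _ b∈ in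
  removal-CM a b a∈′ b∈′ , proj₁ sphere , graded , removal-graded a b a∈′ b∈′
  where open LatticeRemoval K L G
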